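{- Let $N>3$ be odd and let $q$ be a power of $2$. Then $$t_2(N,q)\le 2q^{\frac{N-1}{2}}+t_2^{S^+}(2,q)\left(q^{\frac{N-3}{2}}+q^{\frac{N-5}{2}}+\dots+q+1\right).$$
   Context: A cap in $PG(N,q)$ is a set of points no three collinear; it is complete if not contained in a larger cap; an arc is a cap in $PG(2,q)$. $t_2(N,q)$ denotes the smallest size of a complete cap in $PG(N,q)$. A point is in normalized form if its first nonzero homogeneous coordinate equals $1$. For a complete arc $K$ in $PG(2,q)$ and $Q\notin K$ in normalized form, for every secant $l$ of $K$ through $Q$ write $Q=c_1^{(l)}P_1+c_2^{(l)}P_2$ with $P_1,P_2$ the points of $l\cap K$ in normalized form; $Q$ is a sum-point for $K$ if $c_1^{(l)}=c_2^{(l)}$ for all such $l$. If $K$ has exactly one sum-point, $p(K)$ is the number of secants of $K$ through it. $t_2^{S^+}(2,q)$ denotes the size of the smallest complete $k$-arc $K$ in $PG(2,q)$ with exactly one sum-point and with $(k-2)p(K)<q-1$. -}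

module Defs where

open import Level using (0ℓ)
open import Data.Nat using (ℕ; zero; suc; _^_)
import Data.Nat as ℕ
open import Data.Fin using (Fin; zero; suc; _<_)
open import Data.Fin.Properties using (any?; all?)
open import Data.Product using (Σ; ∃; _×_; _,_; proj₁; proj₂)
open import Data.List using (List; []; _∷_; map; _++_; filter; length)
open import Data.List.Relation.Unary.Any using (Any)
open import Data.List.Relation.Unary.All using (All)
open import Relation.Binary.PropositionalEquality using (_≡_; refl; _≗_; subst; sym)
open import Relation.Binary.Definitions using (DecidableEquality)
open import Relation.Nullary using (¬_; Dec; yes; no)
open import Relation.Nullary.Decidable using (map′)
open import Algebra.Structures using (IsCommutativeRing)
open import Function.Bundles using (_↔_; Inverse)

-- A finite field with q elements (propositional equality).
-- GF(q) is unique up to isomorphism; we quantify over all such fields.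

record FiniteField (q : ℕ) : Set₁ where
  infixl 6 _+_
  infixl 7 _*_
  field
    Carrier : Set
    _+_ _*_ : Carrier → Carrier → Carrier
    -_      : Carrier → Carrier
    0# 1#   : Carrier
    isCommutativeRing : IsCommutativeRing _≡_ _+_ _*_ -_ 0# 1#
    0#≢1#   : ¬ (0# ≡ 1#)
    inverse : ∀ x → ¬ (x ≡ 0#) → ∃ λ y → x * y ≡ 1#
    _≟_     : DecidableEquality Carrier
    enum    : Fin q ↔ Carrier

geomSum : ℕ → ℕ → ℕ
geomSum q zero    = 0
geomSum q (suc k) = q ^ k ℕ.+ geomSum q k

pairs : {A : Set} → List A → List (A × A)
pairs []       = []
pairs (x ∷ xs) = map (x ,_) xs ++ pairs xs

-- Projective geometry PG(n,q) over a finite field F.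
-- Points are represented by homogeneous coordinate vectors in normalized
-- form (first nonzero coordinate equal to 1); two points are equal iff
-- their normalized vectors are pointwise equal.

module Geometry {q : ℕ} (F : FiniteField q) (n : ℕ) where
  open FiniteField F

  Vect : Set
  Vect = Fin (suc n) → Carrier

  _·_ : Carrier → Vect → Vect
  (c · v) i = c * v i

  _⊕_ : Vect → Vect → Vect
  (u ⊕ v) i = u i + v i

  zeroV : Vect
  zeroV _ = 0#

  Normalized : Vect → Set
  Normalized v = Σ (Fin (suc n)) λ i → (v i ≡ 1#) × (∀ j → j < i → v j ≡ 0#)

  Collinear : Vect → Vect → Vect → Set
  Collinear P Q R = Σ Carrier λ a → Σ Carrier λ b → Σ Carrier λ c →
    ¬ (a ≡ 0# × b ≡ 0# × c ≡ 0#) × (((a · P) ⊕ (b · Q)) ⊕ (c · R)) ≗ zeroV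

  _∈ₚ_ : Vect → List Vect → Set
  P ∈ₚ K = Any (λ R → R ≗ P) K

  Distinct : List Vect → Set
  Distinct []       = Data.Unit.⊤ where import Data.Unit
  Distinct (P ∷ K)  = All (λ R → ¬ (R ≗ P)) K × Distinct K

  IsCap : List Vect → Set
  IsCap K = All Normalized K × Distinct K ×
    (∀ P Q R → P ∈ₚ K → Q ∈ₚ K → R ∈ₚ K →
       ¬ (P ≗ Q) → ¬ (P ≗ R) → ¬ (Q ≗ R) → ¬ Collinear P Q R)

  IsCompleteCap : List Vect → Set
  IsCompleteCap K = IsCap K ×
    (∀ Q → Normalized Q → ¬ (Q ∈ₚ K) → ¬ IsCap (Q ∷ K))

  OnLine : Vect → Vect → Vect → Set
  OnLine Q P₁ P₂ = Σ Carrier λ c₁ → Σ Carrier λ c₂ → Q ≗ ((c₁ · P₁) ⊕ (c₂ · P₂))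

  IsSumPoint : List Vect → Vect → Set
  IsSumPoint K Q = Normalized Q × ¬ (Q ∈ₚ K) ×
    (∀ P₁ P₂ → P₁ ∈ₚ K → P₂ ∈ₚ K → ¬ (P₁ ≗ P₂) →
       ∀ c₁ c₂ → Q ≗ ((c₁ · P₁) ⊕ (c₂ · P₂)) → c₁ ≡ c₂)

  HasUniqueSumPoint : List Vect → Vect → Set
  HasUniqueSumPoint K Q = IsSumPoint K Q × (∀ Q′ → IsSumPoint K Q′ → Q′ ≗ Q)

  private
    ≗? : (u v : Vect) → Dec (u ≗ v)
    ≗? u v = all? (λ i → u i ≟ v i)

    to   = Inverse.to enum
    from = Inverse.from enum

    toFrom : ∀ c → to (from c) ≡ c
    toFrom c = Inverse.inverseˡ enum refl

  onLine? : (Q P₁ P₂ : Vect) → Dec (OnLine Q P₁ P₂)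
  onLine? Q P₁ P₂ =
    map′ (λ { (i , j , e) → to i , to j , e })
         (λ { (c₁ , c₂ , e) → from c₁ , from c₂ ,
               subst (λ d → Q ≗ ((to (from c₁) · P₁) ⊕ (d · P₂))) (sym (toFrom c₂))
                 (subst (λ d → Q ≗ ((d · P₁) ⊕ (c₂ · P₂))) (sym (toFrom c₁)) e) })
         (any? λ i → any? λ j → ≗? Q ((to i · P₁) ⊕ (to j · P₂)))

  -- number of secants of K through Q (K a list of distinct points)
  secantsThrough : List Vect → Vect → ℕ
  secantsThrough K Q = length (filter (λ pr → onLine? Q (proj₁ pr) (proj₂ pr)) (pairs K))

{-# OPTIONS --safe #-}
module Submission where

-- Write N = 2s + 1 and par x = (x₁, x₁², …, x_s, x_s²). In characteristic two the points (P, par x),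
-- with P in an arc K, form a cap, and the secant of (P₁, par x), (P₂, par y) with coefficients c₁ ≠ c₂
-- can be made to pass through any (c₁P₁ + c₂P₂, w), since the equations c₁x + c₂y = u, c₁x² + c₂y² = v are
-- then uniquely solvable. So only the vectors (Q, w) and (0, w) stay uncovered, Q being the sum-point.
-- Choose A, B ∈ K with Q off the line AB as coordinate points, so that Q = (1, 0, 0): the uncovered
-- vectors (α, 0, 0, w) form a smaller space of the same shape, where the construction is repeated.
-- This gives layers of sizes k q^(s-1), …, k q, k in the hyperplane at infinity. A point of a deeper layer
-- with plane part A or B lies on no secant of an earlier one; otherwise it does only if its plane part
-- (α, β, γ), where α ≠ 0, satisfies αγc = β² for some c with Q = c(P₁ + P₂). Rescaling γ by μ avoids this: each of the k - 2 points other than A and B and each of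
-- the p(K) values c excludes at most one μ ≠ 0, and (k - 2) p(K) < q - 1.
-- Finally the 2 q^s affine points (a, 1, par x), a ∈ {0, 1/c₀}, with c₀ one of these c, cover everything
-- off the hyperplane, while their directions meet no layer by the same condition.

open import Defs
open import Data.Nat using (ℕ; _^_; _∸_; _<_; _≤_; _%_; _/_)
open import Data.Product using (Σ; _×_)
open import Data.List using (List; length)
open import Relation.Binary.PropositionalEquality using (_≡_)

open import Level using (0ℓ)
open import Algebra.Bundles using (CommutativeRing; RawRing)
import Algebra.Properties.CommutativeMonoid.Sum as Sum
import Algebra.Properties.Ring as RingProperties
import Algebra.Properties.Semiring.Mult as Mult
import Algebra.Solver.Ring as RingSolver
open import Algebra.Solver.Ring.AlmostCommutativeRing using (AlmostCommutativeRing; fromCommutativeRing; _-Raw-AlmostCommutative⟶_)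
open import Data.Bool using (Bool; true; false; _xor_; _∧_)
open import Data.Empty using (⊥; ⊥-elim)
open import Data.Fin using (Fin; zero; suc; punchOut)
import Data.Fin as Fin
open import Data.Fin.Patterns using (0F; 1F; 2F)
open import Data.Fin.Properties using (all?; any?; pigeonhole; injective⇒≤; punchOut-injective; <⇒≢; <-cmp; toℕ<n)
open import Data.List using ([]; _∷_)
import Data.List as List
open import Data.List.Membership.Propositional using (_∈_; _∉_; find; lose)
open import Data.List.Membership.Propositional.Properties using (∈-map⁺; ∈-map⁻; ∈-++⁺ˡ; ∈-++⁺ʳ; ∈-++⁻; ∈-filter⁺; ∈-cartesianProductWith⁺; ∈-cartesianProductWith⁻; ∈-allFin)
import Data.List.Properties as List
import Data.List.Relation.Unary.All as All
open import Data.List.Relation.Unary.All using ([]; _∷_)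
open import Data.List.Relation.Unary.All.Properties using (¬Any⇒All¬)
import Data.List.Relation.Unary.Any as Any
open import Data.List.Relation.Unary.Any using (here; there; index)
open import Data.List.Relation.Unary.Any.Properties using (lookup-index)
open import Data.Maybe using (Maybe; just; nothing)
open import Data.Nat using (zero; suc; z≤n; s≤s)
import Data.Nat as ℕ
open import Data.Nat.DivMod using (m≡m%n+[m/n]*n; m*n/n≡m)
import Data.Nat.Properties as ℕ
open import Data.Product using (∃; _,_; proj₁; proj₂)
open import Data.Sum using (_⊎_; inj₁; inj₂)
open import Data.Unit using (⊤; tt)
open import Data.Vec using (Vec; []; _∷_; _++_; replicate; lookup; tabulate)
import Data.Vec as Vec
open import Data.Vec.Properties using (lookup∘tabulate)
open import Function using (_∘_)
open import Function.Bundles using (_↔_; Inverse; mk↔ₛ′)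
open import Function.Definitions using (Injective)
open import Relation.Binary.Definitions using (tri<; tri≈; tri>)
open import Relation.Binary.PropositionalEquality using (refl; sym; trans; cong; cong₂; subst; _≢_; _≗_; module ≡-Reasoning)
open import Relation.Nullary using (¬_; Dec; yes; no; contradiction)
open import Relation.Nullary.Decidable using (_×-dec_; ¬?; decidable-stable)

open ≡-Reasoning

-- Finite fields of even order

-- Squaring is additive, so with equal coefficients c (par x + par y) = c par (x + y): such joins
-- reach only the multiples of parabola points, whereas unequal nonzero coefficients reach
-- everything. The same degeneracy leaves room for the deeper layers. A vector (α, 0, 0, w) lies on
-- a join of two points of the outer layer only if w = d par t, where d = cα if the two points lie
-- over distinct P₁, P₂ with Q = c(P₁ + P₂), and d is arbitrary if α = 0 and they lie over the same
-- P. If (β, γ) is the first block of w, then β = dt and γ = dt²; eliminating t from d = cα gives β²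
-- = cαγ, the equation to be avoided. The coordinate points A and B have α = 0 and exactly one of β,
-- γ equal to 0, which no d par t allows; this is why only k - 2 points are counted. Rescaling γ
-- fixes Q, A and B and keeps K an arc, while it moves the other points relative to the conics β² =
-- cαγ. The inequality also forces q > 2. Then some θ differs from 0 and 1, and a point of K gets
-- the representation P = θP + (1 + θ)P with unequal nonzero coefficients.

endo-injective⇒surjective : ∀ {n} (f : Fin n → Fin n) → Injective _≡_ _≡_ f →
  ∀ y → ∃ λ x → f x ≡ y
endo-injective⇒surjective {suc n} f inj y with any? (λ x → f x Fin.≟ y)
... | yes found = found
... | no none = contradiction (injective⇒≤ {f = λ x → punchOut (y≢f x)} squeezed) ℕ.1+n≰n
  where
  y≢f : ∀ x → y ≢ f x
  y≢f x e = none (x , sym e)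

  squeezed : Injective _≡_ _≡_ (λ x → punchOut (y≢f x))
  squeezed {x} {x′} e = inj (punchOut-injective (y≢f x) (y≢f x′) e)

module Field {q : ℕ} (F : FiniteField q) where
  open FiniteField F public
    using (Carrier; _+_; _*_; -_; 0#; 1#; 0#≢1#; inverse; _≟_; enum)

  commutativeRing : CommutativeRing 0ℓ 0ℓ
  commutativeRing = record { isCommutativeRing = FiniteField.isCommutativeRing F }

  open CommutativeRing commutativeRing public
    using ( +-comm; +-assoc; +-identityˡ; +-identityʳ; *-comm; *-assoc; *-identityˡ; *-identityʳ
          ; zeroˡ; zeroʳ; distribˡ; distribʳ; -‿inverseˡ; -‿inverseʳ; semiring; ring
          ; +-commutativeMonoid)

  element : Fin q → Carrier
  element = Inverse.to enum

  position : Carrier → Fin q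
  position = Inverse.from enum

  element-position : ∀ c → element (position c) ≡ c
  element-position c = Inverse.inverseˡ enum refl

  position-element : ∀ i → position (element i) ≡ i
  position-element i = Inverse.inverseʳ enum refl

  element-injective : Injective _≡_ _≡_ element
  element-injective {i} {j} e =
    trans (sym (position-element i)) (trans (cong position e) (position-element j))

  abstract
    -- Total, with the value 0 at 0, so that quotients can be formed before their denominators are
    -- known to be nonzero; the entries of `excluded` rely on this.
    inv : Carrier → Carrier
    inv x with x ≟ 0#
    ... | yes _  = 0#
    ... | no x≢0 = proj₁ (inverse x x≢0)

    *-invʳ : ∀ {x} → x ≢ 0# → x * inv x ≡ 1#
    *-invʳ {x} x≢0 with x ≟ 0#
    ... | yes x≡0 = contradiction x≡0 x≢0
    ... | no x≢0′ = proj₂ (inverse x x≢0′)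

    *-invˡ : ∀ {x} → x ≢ 0# → inv x * x ≡ 1#
    *-invˡ x≢0 = trans (*-comm _ _) (*-invʳ x≢0)

  inv-*-cancel : ∀ {x} → x ≢ 0# → ∀ y → inv x * (x * y) ≡ y
  inv-*-cancel {x} x≢0 y =
    trans (sym (*-assoc _ _ _)) (trans (cong (_* y) (*-invˡ x≢0)) (*-identityˡ y))

  *-inv-cancel : ∀ {x} → x ≢ 0# → ∀ y → x * (inv x * y) ≡ y
  *-inv-cancel {x} x≢0 y =
    trans (sym (*-assoc _ _ _)) (trans (cong (_* y) (*-invʳ x≢0)) (*-identityˡ y))

  *-cancel : ∀ {x} → x ≢ 0# → ∀ {y z} → x * y ≡ x * z → y ≡ z
  *-cancel x≢0 {y} {z} e =
    trans (sym (inv-*-cancel x≢0 y)) (trans (cong (inv _ *_) e) (inv-*-cancel x≢0 z))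

  *-zero-cancel : ∀ {x} → x ≢ 0# → ∀ {y} → x * y ≡ 0# → y ≡ 0#
  *-zero-cancel x≢0 e = *-cancel x≢0 (trans e (sym (zeroʳ _)))

  *-nonzero : ∀ {x y} → x ≢ 0# → y ≢ 0# → x * y ≢ 0#
  *-nonzero x≢0 y≢0 = y≢0 ∘ *-zero-cancel x≢0

  inv-nonzero : ∀ {x} → x ≢ 0# → inv x ≢ 0#
  inv-nonzero {x} x≢0 e =
    0#≢1# (trans (sym (zeroʳ x)) (trans (cong (x *_) (sym e)) (*-invʳ x≢0)))

  square-zero : ∀ {x} → x * x ≡ 0# → x ≡ 0#
  square-zero {x} e with x ≟ 0#
  ... | yes x≡0 = x≡0
  ... | no  x≢0 = *-zero-cancel x≢0 e

  abstract
    -- If every field element occurred in `xs`, sending each to the index of an occurrence would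
    -- inject q elements into fewer places. Both free parameters, μ and θ, are chosen in this way.
    avoiding : (xs : List Carrier) → length xs < q → ∃ (_∉ xs)
    avoiding xs |xs|<q with any? (λ i → ¬? (Any.any? (element i ≟_) xs))
    ... | yes (i , i∉) = element i , i∉
    ... | no none = contradiction (pigeonhole |xs|<q (index ∘ covered)) separated
      where
      covered : ∀ i → element i ∈ xs
      covered i = decidable-stable (Any.any? (element i ≟_) xs) (λ i∉ → none (i , i∉))

      separated : ¬ (∃ λ i → ∃ λ j → i Fin.< j × index (covered i) ≡ index (covered j))
      separated (i , j , i<j , e) = <⇒≢ i<j (element-injective (begin
        element i                            ≡⟨ lookup-index (covered i) ⟩
        List.lookup xs (index (covered i))   ≡⟨ cong (List.lookup xs) e ⟩
        List.lookup xs (index (covered j))   ≡⟨ lookup-index (covered j) ⟨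
        element j                            ∎))

  private
    module S = Sum +-commutativeMonoid
    open Mult semiring using (×1-homo-*) renaming (_×_ to _×′_)

    -- Translation by 1 permutes the field, so summing all elements gives q · 1 = 0.
    order-kills-one : q ×′ 1# ≡ 0#
    order-kills-one = begin
      q ×′ 1#                              ≡⟨ +-identityʳ _ ⟨
      q ×′ 1# + 0#                         ≡⟨ cong (q ×′ 1# +_) (-‿inverseʳ total) ⟨
      q ×′ 1# + (total + - total)          ≡⟨ +-assoc _ _ _ ⟨
      (q ×′ 1# + total) + - total          ≡⟨ cong (_+ - total) (+-comm _ _) ⟩
      (total + q ×′ 1#) + - total          ≡⟨ cong (λ z → (total + z) + - total) (S.sum-replicate q) ⟨
      (total + S.sum ones) + - total       ≡⟨ cong (_+ - total) (S.∑-distrib-+ element ones) ⟨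
      S.sum (λ i → element i + 1#) + - total
        ≡⟨ cong (_+ - total) (S.sum-cong-≗ (λ i → element-position (element i + 1#))) ⟨
      S.sum (λ i → element (shift i)) + - total
        ≡⟨ cong (_+ - total) (S.sum-permute element shiftPermutation) ⟨
      total + - total                      ≡⟨ -‿inverseʳ total ⟩
      0#                                   ∎
      where
      total : Carrier
      total = S.sum element

      ones : Fin q → Carrier
      ones _ = 1#

      shift unshift : Fin q → Fin q
      shift   i = position (element i + 1#)
      unshift i = position (element i + - 1#)

      cancel₁ : ∀ x → (x + - 1#) + 1# ≡ x
      cancel₁ x = trans (+-assoc _ _ _) (trans (cong (x +_) (-‿inverseˡ 1#)) (+-identityʳ x))

      cancel₂ : ∀ x → (x + 1#) + - 1# ≡ x
      cancel₂ x = trans (+-assoc _ _ _) (trans (cong (x +_) (-‿inverseʳ 1#)) (+-identityʳ x))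

      shiftPermutation : Fin q ↔ Fin q
      shiftPermutation = mk↔ₛ′ shift unshift
        (λ i → trans (cong (λ z → position (z + 1#)) (element-position _))
                     (trans (cong position (cancel₁ _)) (position-element i)))
        (λ i → trans (cong (λ z → position (z + - 1#)) (element-position _))
                     (trans (cong position (cancel₂ _)) (position-element i)))

    -- A nonzero factor 2 could be cancelled; cancelling all of them would leave 1 = 0.
    power-kills-one : ∀ m → (2 ^ m) ×′ 1# ≡ 0# → 1# + 1# ≡ 0#
    power-kills-one zero e = contradiction (sym (trans (sym (+-identityʳ 1#)) e)) 0#≢1#
    power-kills-one (suc m) e with (1# + 1#) ≟ 0#
    ... | yes two≡0 = two≡0
    ... | no two≢0 = power-kills-one m (*-zero-cancel two≢0 (begin
      (1# + 1#) * ((2 ^ m) ×′ 1#)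
        ≡⟨ cong (λ z → (1# + z) * ((2 ^ m) ×′ 1#)) (+-identityʳ 1#) ⟨
      (2 ×′ 1#) * ((2 ^ m) ×′ 1#)  ≡⟨ ×1-homo-* 2 (2 ^ m) ⟨
      (2 ℕ.* 2 ^ m) ×′ 1#          ≡⟨ e ⟩
      0#                           ∎))

  abstract
    characteristic-two : ∀ m → q ≡ 2 ^ m → 1# + 1# ≡ 0#
    characteristic-two m q≡2^m =
      power-kills-one m (trans (cong (_×′ 1#) (sym q≡2^m)) order-kills-one)

module Char2 {q : ℕ} (F : FiniteField q)
  (1+1≡0 : FiniteField._+_ F (FiniteField.1# F) (FiniteField.1# F) ≡ FiniteField.0# F) where
  open Field F public

  x+x≡0 : ∀ x → x + x ≡ 0#
  x+x≡0 x = begin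
    x + x              ≡⟨ cong₂ _+_ (*-identityʳ x) (*-identityʳ x) ⟨
    x * 1# + x * 1#    ≡⟨ distribˡ x 1# 1# ⟨
    x * (1# + 1#)      ≡⟨ cong (x *_) 1+1≡0 ⟩
    x * 0#             ≡⟨ zeroʳ x ⟩
    0#                 ∎

  private
    bit : Bool → Carrier
    bit false = 0#
    bit true  = 1#

    -- The two-element field as coefficient ring makes the solver reduce x + x to 0, so that
    -- identities special to characteristic two close by `refl`.
    boolRing : RawRing 0ℓ 0ℓ
    boolRing = record
      { Carrier = Bool ; _≈_ = _≡_ ; _+_ = _xor_ ; _*_ = _∧_
      ; -_ = λ b → b ; 0# = false ; 1# = true }

    almostRing : AlmostCommutativeRing 0ℓ 0ℓ
    almostRing = fromCommutativeRing commutativeRing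

    open RingProperties ring using (-0#≈0#)

    bitMorphism : boolRing -Raw-AlmostCommutative⟶ almostRing
    bitMorphism = record
      { ⟦_⟧ = bit
      ; +-homo = λ { false b → sym (+-identityˡ _) ; true false → sym (+-identityʳ _) ; true true → sym 1+1≡0 }
      ; *-homo = λ { false b → sym (zeroˡ _) ; true b → sym (*-identityˡ _) }
      ; -‿homo = λ { false → sym -0#≈0# ; true → 1≡-1 }
      ; 0-homo = refl
      ; 1-homo = refl
      }
      where
      1≡-1 : 1# ≡ - 1#
      1≡-1 = begin
        1#                 ≡⟨ +-identityʳ 1# ⟨
        1# + 0#            ≡⟨ cong (1# +_) (-‿inverseʳ 1#) ⟨
        1# + (1# + - 1#)   ≡⟨ +-assoc _ _ _ ⟨
        (1# + 1#) + - 1#   ≡⟨ cong (_+ - 1#) 1+1≡0 ⟩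
        0# + - 1#          ≡⟨ +-identityˡ _ ⟩
        - 1#               ∎

    bit≟ : ∀ a b → Maybe (bit a ≡ bit b)
    bit≟ false false = just refl
    bit≟ true  true  = just refl
    bit≟ _     _     = nothing

  open RingSolver boolRing almostRing bitMorphism bit≟ public
    using (Polynomial; solve; _:=_; _:+_; _:*_; con)

  abstract
    +≡0⇒≡ : ∀ {x y} → x + y ≡ 0# → x ≡ y
    +≡0⇒≡ {x} {y} e = begin
      x            ≡⟨ solve 2 (λ x y → x := (x :+ y) :+ y) refl x y ⟩
      x + y + y    ≡⟨ cong (_+ y) e ⟩
      0# + y       ≡⟨ +-identityˡ y ⟩
      y            ∎

    ≡⇒+≡0 : ∀ {x y} → x ≡ y → x + y ≡ 0#
    ≡⇒+≡0 {x} refl = x+x≡0 x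

    square-injective : ∀ {x y} → x * x ≡ y * y → x ≡ y
    square-injective {x} {y} e = +≡0⇒≡ (square-zero (begin
      (x + y) * (x + y)  ≡⟨ solve 2 (λ x y → (x :+ y) :* (x :+ y) := x :* x :+ y :* y) refl x y ⟩
      x * x + y * y      ≡⟨ ≡⇒+≡0 e ⟩
      0#                 ∎))

    -- On a finite set injectivity is enough. These square roots are what solves the quadratic
    -- equation in `parabola-surjective`.
    square-surjective : ∀ x → ∃ λ r → r * r ≡ x
    square-surjective x
      with i , e ← endo-injective⇒surjective (λ i → position (element i * element i))
        (λ {i} {j} e → element-injective (square-injective
          (trans (sym (element-position _)) (trans (cong element e) (element-position _)))))
        (position x)
      = element i , trans (sym (element-position _)) (trans (cong element e) (element-position x))

    -- Squaring c₁ x + c₂ y = u makes both equations linear in x², y², with determinant c₁ c₂ (c₁ + c₂).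
    parabola-surjective : ∀ {c₁ c₂} → c₁ ≢ 0# → c₂ ≢ 0# → c₁ ≢ c₂ → ∀ u v →
      ∃ λ x → ∃ λ y → (c₁ * x + c₂ * y ≡ u) × (c₁ * (x * x) + c₂ * (y * y) ≡ v)
    parabola-surjective {c₁} {c₂} c₁≢0 c₂≢0 c₁≢c₂ u v = x , y , first , second
      where
      d : Carrier
      d = c₂ * (c₁ + c₂)

      d≢0 : d ≢ 0#
      d≢0 = *-nonzero c₂≢0 (c₁≢c₂ ∘ +≡0⇒≡)

      root : ∃ λ r → r * r ≡ inv d * (c₁ * v + u * u)
      root = square-surjective _

      y x : Carrier
      y = proj₁ root
      x = inv c₁ * (u + c₂ * y)

      c₁x : c₁ * x ≡ u + c₂ * y
      c₁x = *-inv-cancel c₁≢0 _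

      dy² : d * (y * y) ≡ c₁ * v + u * u
      dy² = trans (cong (d *_) (proj₂ root)) (*-inv-cancel d≢0 _)

      first : c₁ * x + c₂ * y ≡ u
      first = trans (cong (_+ c₂ * y) c₁x)
                    (solve 2 (λ u z → (u :+ z) :+ z := u) refl u (c₂ * y))

      second : c₁ * (x * x) + c₂ * (y * y) ≡ v
      second = *-cancel c₁≢0 (begin
        c₁ * (c₁ * (x * x) + c₂ * (y * y))
          ≡⟨ solve 4 (λ a b x y → a :* (a :* (x :* x) :+ b :* (y :* y))
                        := (a :* x) :* (a :* x) :+ a :* (b :* (y :* y))) refl c₁ c₂ x y ⟩
        (c₁ * x) * (c₁ * x) + c₁ * (c₂ * (y * y))
          ≡⟨ cong (λ z → z * z + c₁ * (c₂ * (y * y))) c₁x ⟩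
        (u + c₂ * y) * (u + c₂ * y) + c₁ * (c₂ * (y * y))
          ≡⟨ solve 4 (λ a b u y → (u :+ b :* y) :* (u :+ b :* y) :+ a :* (b :* (y :* y))
                        := u :* u :+ (b :* (a :+ b)) :* (y :* y)) refl c₁ c₂ u y ⟩
        u * u + d * (y * y)      ≡⟨ cong (u * u +_) dy² ⟩
        u * u + (c₁ * v + u * u) ≡⟨ solve 2 (λ u w → u :* u :+ (w :+ u :* u) := w) refl u (c₁ * v) ⟩
        c₁ * v                   ∎)

-- Stacking products with parabolas

length-cartesianProductWith : {A B C : Set} (f : A → B → C) (xs : List A) (ys : List B) →
  length (List.cartesianProductWith f xs ys) ≡ length xs ℕ.* length ys
length-cartesianProductWith f [] ys = refl
length-cartesianProductWith f (x ∷ xs) ys = begin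
  length (List.map (f x) ys List.++ List.cartesianProductWith f xs ys)
    ≡⟨ List.length-++ (List.map (f x) ys) ⟩
  length (List.map (f x) ys) ℕ.+ length (List.cartesianProductWith f xs ys)
    ≡⟨ cong₂ ℕ._+_ (List.length-map (f x) ys) (length-cartesianProductWith f xs ys) ⟩
  length ys ℕ.+ length xs ℕ.* length ys ∎

module Linear {q : ℕ} (F : FiniteField q)
  (1+1≡0 : FiniteField._+_ F (FiniteField.1# F) (FiniteField.1# F) ≡ FiniteField.0# F) where
  open Char2 F 1+1≡0 public

  private
    variable
      n m s : ℕ
      a b c d α : Carrier

  Vector : ℕ → Set
  Vector = Vec Carrier

  zeros : ∀ n → Vector n
  zeros n = replicate n 0#

  zeros-++ : ∀ m n → zeros m ++ zeros n ≡ zeros (m ℕ.+ n)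
  zeros-++ zero    n = refl
  zeros-++ (suc m) n = cong (0# ∷_) (zeros-++ m n)

  -- In characteristic two, Dep a b 1# u v z says z = a u + b v.
  Dep : (a b c : Carrier) (u v w : Vector n) → Set
  Dep a b c []      []      []      = ⊤
  Dep a b c (x ∷ u) (y ∷ v) (z ∷ w) = (a * x + b * y + c * z ≡ 0#) × Dep a b c u v w

  Dep-++⁻ : (p₁ p₂ p₃ : Vector m) {u v w : Vector n} →
    Dep a b c (p₁ ++ u) (p₂ ++ v) (p₃ ++ w) → Dep a b c p₁ p₂ p₃ × Dep a b c u v w
  Dep-++⁻ [] [] [] d = tt , d
  Dep-++⁻ (x ∷ p₁) (y ∷ p₂) (z ∷ p₃) (e , d) =
    let d₁ , d₂ = Dep-++⁻ p₁ p₂ p₃ d in (e , d₁) , d₂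

  Dep-++⁺ : (p₁ p₂ p₃ : Vector m) {u v w : Vector n} →
    Dep a b c p₁ p₂ p₃ → Dep a b c u v w → Dep a b c (p₁ ++ u) (p₂ ++ v) (p₃ ++ w)
  Dep-++⁺ [] [] [] tt d = d
  Dep-++⁺ (x ∷ p₁) (y ∷ p₂) (z ∷ p₃) (e , d₁) d₂ = e , Dep-++⁺ p₁ p₂ p₃ d₁ d₂

  abstract
    Dep-swap₁₂ : (u v w : Vector n) → Dep a b c u v w → Dep b a c v u w
    Dep-swap₁₂ [] [] [] d = d
    Dep-swap₁₂ {c = c} (x ∷ u) (y ∷ v) (z ∷ w) (e , d) =
      trans (cong (_+ c * z) (+-comm _ _)) e , Dep-swap₁₂ u v w d

    Dep-swap₂₃ : (u v w : Vector n) → Dep a b c u v w → Dep a c b u w v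
    Dep-swap₂₃ [] [] [] d = d
    Dep-swap₂₃ {a = a} {b} {c} (x ∷ u) (y ∷ v) (z ∷ w) (e , d) =
      trans (trans (+-assoc _ _ _) (trans (cong (a * x +_) (+-comm _ _)) (sym (+-assoc _ _ _)))) e ,
      Dep-swap₂₃ u v w d

    -- A vector under a zero coefficient is only a placeholder. Relations with fewer terms are
    -- therefore written as three-term ones, and the placeholder is exchanged for whatever the next
    -- lemma expects.
    Dep-replace₃ : (u v w w′ : Vector n) → Dep a b 0# u v w → Dep a b 0# u v w′
    Dep-replace₃ [] [] [] [] d = d
    Dep-replace₃ {a = a} {b} (x ∷ u) (y ∷ v) (z ∷ w) (z′ ∷ w′) (e , d) =
      trans (cong (a * x + b * y +_) (trans (zeroˡ z′) (sym (zeroˡ z)))) e , Dep-replace₃ u v w w′ d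

    Dep-replace₂ : (u v v′ w w′ : Vector n) → Dep a 0# 0# u v w → Dep a 0# 0# u v′ w′
    Dep-replace₂ u v v′ w w′ d =
      Dep-swap₂₃ u w′ v′ (Dep-replace₃ u w′ v v′ (Dep-swap₂₃ u v w′ (Dep-replace₃ u v w w′ d)))

    Dep-merge : (u v w : Vector n) → Dep a b c u u v → Dep (a + b) c 0# u v w
    Dep-merge [] [] [] d = d
    Dep-merge {a = a} {b} {c} (x ∷ u) (y ∷ v) (z ∷ w) (e , d) =
      trans (solve 6 (λ a b c x y z → (a :+ b) :* x :+ c :* y :+ con false :* z
                       := a :* x :+ b :* x :+ c :* y) refl a b c x y z) e ,
      Dep-merge u v w d

    Dep-zeros : ∀ n → Dep a b c (zeros n) (zeros n) (zeros n)
    Dep-zeros zero = tt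
    Dep-zeros {a} {b} {c} (suc n) =
      trans (cong₂ _+_ (trans (cong₂ _+_ (zeroʳ a) (zeroʳ b)) (+-identityˡ 0#)) (zeroʳ c)) (+-identityˡ 0#) ,
      Dep-zeros n

  Trivial : (a b c : Carrier) → Set
  Trivial a b c = a ≡ 0# × b ≡ 0# × c ≡ 0#

  Coincide : (a b c : Carrier) (u v w : Vector n) → Set
  Coincide a b c u v w = u ≡ v ⊎ u ≡ w ⊎ v ≡ w ⊎ Trivial a b c

  coincide-swap₁₂ : {u v w : Vector n} → Coincide a b c u v w → Coincide b a c v u w
  coincide-swap₁₂ (inj₁ e) = inj₁ (sym e)
  coincide-swap₁₂ (inj₂ (inj₁ e)) = inj₂ (inj₂ (inj₁ e))
  coincide-swap₁₂ (inj₂ (inj₂ (inj₁ e))) = inj₂ (inj₁ e)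
  coincide-swap₁₂ (inj₂ (inj₂ (inj₂ (x , y , z)))) = inj₂ (inj₂ (inj₂ (y , x , z)))

  coincide-swap₂₃ : {u v w : Vector n} → Coincide a b c u v w → Coincide a c b u w v
  coincide-swap₂₃ (inj₁ e) = inj₂ (inj₁ e)
  coincide-swap₂₃ (inj₂ (inj₁ e)) = inj₁ e
  coincide-swap₂₃ (inj₂ (inj₂ (inj₁ e))) = inj₂ (inj₂ (inj₁ (sym e)))
  coincide-swap₂₃ (inj₂ (inj₂ (inj₂ (x , y , z)))) = inj₂ (inj₂ (inj₂ (x , z , y)))

  -- Members are nonzero, distinct members are not proportional, and no three are collinear. The
  -- last condition does not contain the others, because it is satisfied by any triple with a
  -- repetition.
  record Cap (L : List (Vector n)) : Set where
    field
      independent₁ : ∀ {u v w} → u ∈ L → Dep a 0# 0# u v w → a ≡ 0#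
      independent₂ : ∀ {u v w} → u ∈ L → v ∈ L → Dep a b 0# u v w → u ≡ v ⊎ (a ≡ 0# × b ≡ 0#)
      independent₃ : ∀ {u v w} → u ∈ L → v ∈ L → w ∈ L → Dep a b c u v w → Coincide a b c u v w

  -- The two members may coincide and the coefficients may vanish, so members and the zero vector
  -- count as covered; `Completion` sorts these cases out.
  Covers : List (Vector n) → Vector n → Set
  Covers L z = ∃ λ u → ∃ λ v → ∃ λ c₁ → ∃ λ c₂ → u ∈ L × v ∈ L × Dep c₁ c₂ 1# u v z

  par : Vector s → Vector (s ℕ.* 2)
  par []      = []
  par (x ∷ xs) = x ∷ x * x ∷ par xs

  allVectors : ∀ s → List (Vector s)
  allVectors zero    = [] ∷ []
  allVectors (suc s) = List.cartesianProductWith _∷_ (List.map element (List.allFin q)) (allVectors s)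

  ∈-allVectors : (x : Vector s) → x ∈ allVectors s
  ∈-allVectors [] = here refl
  ∈-allVectors (x ∷ xs) = ∈-cartesianProductWith⁺ _∷_
    (subst (_∈ List.map element (List.allFin q)) (element-position x) (∈-map⁺ element (∈-allFin (position x)))) (∈-allVectors xs)

  length-allVectors : ∀ s → length (allVectors s) ≡ q ^ s
  length-allVectors zero = refl
  length-allVectors (suc s) = trans
    (length-cartesianProductWith _∷_ (List.map element (List.allFin q)) (allVectors s))
    (cong₂ ℕ._*_ (trans (List.length-map element (List.allFin q)) (List.length-tabulate {n = q} (λ i → i))) (length-allVectors s))

  par-cancel₂ : a ≢ 0# → (x y : Vector s) {w : Vector (s ℕ.* 2)} → Dep a a 0# (par x) (par y) w → x ≡ y
  par-cancel₂ a≢0 [] [] d = refl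
  par-cancel₂ {a} a≢0 (x ∷ xs) (y ∷ ys) {z ∷ z′ ∷ w} (e , _ , d) =
    cong₂ _∷_ (*-cancel a≢0 (+≡0⇒≡ (trans (sym (trans (cong (a * x + a * y +_) (zeroˡ z)) (+-identityʳ _))) e)))
              (par-cancel₂ a≢0 xs ys d)

  -- With U = x + z and V = y + z the relations read a U = b V and a U² = b V², so b V (U + V) = 0.
  par-cancel₃ : a ≢ 0# → b ≢ 0# → a + b ≢ 0# → (x y z : Vector s) →
    Dep a b (a + b) (par x) (par y) (par z) → x ≡ y
  par-cancel₃ a≢0 b≢0 a+b≢0 [] [] [] d = refl
  par-cancel₃ {a} {b} a≢0 b≢0 a+b≢0 (x ∷ xs) (y ∷ ys) (z ∷ zs) (e₁ , e₂ , d) =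
    cong₂ _∷_ x≡y (par-cancel₃ a≢0 b≢0 a+b≢0 xs ys zs d)
    where
    U V : Carrier
    U = x + z
    V = y + z

    aU≡bV : a * U ≡ b * V
    aU≡bV = +≡0⇒≡ (trans (solve 5 (λ a b x y z → a :* (x :+ z) :+ b :* (y :+ z)
                                     := a :* x :+ b :* y :+ (a :+ b) :* z) refl a b x y z) e₁)

    aU²≡bV² : a * (U * U) ≡ b * (V * V)
    aU²≡bV² = +≡0⇒≡ (trans (solve 5 (λ a b x y z →
        a :* ((x :+ z) :* (x :+ z)) :+ b :* ((y :+ z) :* (y :+ z))
          := a :* (x :* x) :+ b :* (y :* y) :+ (a :+ b) :* (z :* z)) refl a b x y z) e₂)

    bVU≡bVV : b * (V * U) ≡ b * (V * V)
    bVU≡bVV = begin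
      b * (V * U)   ≡⟨ *-assoc b V U ⟨
      (b * V) * U   ≡⟨ cong (_* U) aU≡bV ⟨
      (a * U) * U   ≡⟨ *-assoc a U U ⟩
      a * (U * U)   ≡⟨ aU²≡bV² ⟩
      b * (V * V)   ∎

    U≡V : U ≡ V
    U≡V with V ≟ 0#
    ... | no V≢0 = *-cancel V≢0 (*-cancel b≢0 bVU≡bVV)
    ... | yes V≡0 = trans (*-zero-cancel a≢0 (trans aU≡bV (trans (cong (b *_) V≡0) (zeroʳ b)))) (sym V≡0)

    x≡y : x ≡ y
    x≡y = +≡0⇒≡ (trans (solve 3 (λ x y z → x :+ y := (x :+ z) :+ (y :+ z)) refl x y z) (≡⇒+≡0 U≡V))

  par-surjective : a ≢ 0# → b ≢ 0# → a ≢ b → (w : Vector (s ℕ.* 2)) →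
    ∃ λ (x : Vector s) → ∃ λ (y : Vector s) → Dep a b 1# (par x) (par y) w
  par-surjective {s = zero} a≢0 b≢0 a≢b [] = [] , [] , tt
  par-surjective {s = suc s} a≢0 b≢0 a≢b (u ∷ v ∷ w)
    with x , y , e₁ , e₂ ← parabola-surjective a≢0 b≢0 a≢b u v
       | xs , ys , d ← par-surjective {s = s} a≢0 b≢0 a≢b w
    = x ∷ xs , y ∷ ys ,
      ≡⇒+≡0 (trans e₁ (sym (*-identityˡ u))) , ≡⇒+≡0 (trans e₂ (sym (*-identityˡ v))) , d

  -- Products of a cap with parabola points

  module Product {B : List (Vector n)} (B-cap : Cap B) where
    open Cap B-cap

    product₁ : ∀ {p} {x : Vector s} {v w} → p ∈ B → Dep a 0# 0# (p ++ par x) v w → a ≡ 0#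
    product₁ {p = p} {x} p∈ d = independent₁ p∈
      (proj₁ (Dep-++⁻ p p p (Dep-replace₂ (p ++ par x) _ (p ++ par x) _ (p ++ par x) d)))

    product₂ : ∀ {p₁ p₂} {x y : Vector s} {w} → p₁ ∈ B → p₂ ∈ B →
      Dep a b 0# (p₁ ++ par x) (p₂ ++ par y) w →
      p₁ ++ par x ≡ p₂ ++ par y ⊎ (a ≡ 0# × b ≡ 0#)
    product₂ {a = a} {b} {p₁ = p₁} {p₂} {x} {y} {w} p₁∈ p₂∈ d
      with Dep-++⁻ p₁ p₂ p₂ (Dep-replace₃ (p₁ ++ par x) (p₂ ++ par y) w (p₂ ++ par y) d)
    ... | d₁ , d₂ with independent₂ p₁∈ p₂∈ d₁
    ...   | inj₂ trivial = inj₂ trivial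
    ...   | inj₁ refl with +≡0⇒≡ (independent₁ p₁∈ (Dep-merge p₁ p₁ p₁ d₁))
    ...     | refl with a ≟ 0#
    ...       | yes a≡0 = inj₂ (a≡0 , a≡0)
    ...       | no  a≢0 = inj₁ (cong (λ t → p₁ ++ par t) (par-cancel₂ a≢0 x y d₂))

    private
      -- The relation restricted to the base is (a + b + c) p = 0, hence c = a + b, which is the
      -- form that `par-cancel₃` handles. A vanishing coefficient leaves a two-term relation for
      -- `product₂`.
      same-base : ∀ {p} {x y z : Vector s} → p ∈ B →
        Dep a b c (p ++ par x) (p ++ par y) (p ++ par z) →
        Coincide a b c (p ++ par x) (p ++ par y) (p ++ par z)
      same-base {a = a} {b} {c} {p = p} {x} {y} {z} p∈ d
        with Dep-++⁻ p p p d
      ... | d₁ , d₂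
        with +≡0⇒≡ {c} {a + b} (trans (+-comm c (a + b))
               (independent₁ p∈ (Dep-replace₂ p p p p p (Dep-merge p p p (Dep-merge p p p d₁)))))
      ... | refl with a ≟ 0# | b ≟ 0# | (a + b) ≟ 0#
      ...   | no a≢0 | no b≢0 | no c≢0 =
              inj₁ (cong (λ t → p ++ par t) (par-cancel₃ a≢0 b≢0 c≢0 x y z d₂))
      ...   | no a≢0 | no b≢0 | yes c≡0 with product₂ p∈ p∈ (subst (λ c → Dep a b c (p ++ par x) (p ++ par y) (p ++ par z)) c≡0 d)
      ...     | inj₁ e = inj₁ e
      ...     | inj₂ (a≡0 , _) = contradiction a≡0 a≢0
      same-base {a = a} {b} {p = p} {x} {y} {z} p∈ d | d₁ , d₂ | refl | no a≢0 | yes refl | _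
        with product₂ p∈ p∈ (Dep-swap₂₃ (p ++ par x) (p ++ par y) (p ++ par z) d)
      ... | inj₁ e = inj₂ (inj₁ e)
      ... | inj₂ (a≡0 , _) = contradiction a≡0 a≢0
      same-base {a = a} {b} {p = p} {x} {y} {z} p∈ d | d₁ , d₂ | refl | yes refl | _ | _
        with product₂ p∈ p∈ (Dep-swap₂₃ (p ++ par y) (p ++ par x) (p ++ par z) (Dep-swap₁₂ (p ++ par x) (p ++ par y) (p ++ par z) d))
      ... | inj₁ e = inj₂ (inj₂ (inj₁ e))
      ... | inj₂ (b≡0 , c≡0) = inj₂ (inj₂ (inj₂ (refl , b≡0 , c≡0)))

      -- On the base the relation is (a + b) p + c p₃ = 0: either p₃ is p, or c = 0 and the third
      -- point drops out.
      same-base₁₂ : ∀ {p p₃} {x y z : Vector s} → p ∈ B → p₃ ∈ B →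
        Dep a b c (p ++ par x) (p ++ par y) (p₃ ++ par z) →
        Coincide a b c (p ++ par x) (p ++ par y) (p₃ ++ par z)
      same-base₁₂ {p = p} {p₃} p∈ p₃∈ d
        with independent₂ p∈ p₃∈ (Dep-merge p p₃ p (proj₁ (Dep-++⁻ p p p₃ d)))
      ... | inj₁ refl = same-base p∈ d
      ... | inj₂ (_ , refl) with product₂ p∈ p∈ d
      ...   | inj₁ e = inj₁ e
      ...   | inj₂ (a≡0 , b≡0) = inj₂ (inj₂ (inj₂ (a≡0 , b≡0 , refl)))

    product₃ : ∀ {p₁ p₂ p₃} {x y z : Vector s} → p₁ ∈ B → p₂ ∈ B → p₃ ∈ B →
      Dep a b c (p₁ ++ par x) (p₂ ++ par y) (p₃ ++ par z) →
      Coincide a b c (p₁ ++ par x) (p₂ ++ par y) (p₃ ++ par z)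
    product₃ {p₁ = p₁} {p₂} {p₃} {x} {y} {z} p₁∈ p₂∈ p₃∈ d
      with independent₃ p₁∈ p₂∈ p₃∈ (proj₁ (Dep-++⁻ p₁ p₂ p₃ d))
    ... | inj₁ refl = same-base₁₂ p₁∈ p₃∈ d
    ... | inj₂ (inj₁ refl) = coincide-swap₂₃ (same-base₁₂ p₁∈ p₂∈
            (Dep-swap₂₃ (p₁ ++ par x) (p₂ ++ par y) (p₁ ++ par z) d))
    ... | inj₂ (inj₂ (inj₁ refl)) =
            coincide-swap₁₂ (coincide-swap₂₃ (same-base₁₂ p₂∈ p₁∈
              (Dep-swap₂₃ (p₂ ++ par y) (p₁ ++ par x) (p₂ ++ par z)
                (Dep-swap₁₂ (p₁ ++ par x) (p₂ ++ par y) (p₂ ++ par z) d))))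
    ... | inj₂ (inj₂ (inj₂ trivial)) = inj₂ (inj₂ (inj₂ trivial))

  -- Placing a smaller cap in the space that a product leaves uncovered

  stack : List (Vector (suc m)) → List (Vector (suc (s ℕ.* 2))) → List (Vector (suc (m ℕ.+ s ℕ.* 2)))
  stack {m} {s} B C =
    List.cartesianProductWith (λ p x → p ++ par x) B (allVectors s) List.++
    List.map (λ v → Vec.head v ∷ zeros m ++ Vec.tail v) C

  length-stack : (B : List (Vector (suc m))) (C : List (Vector (suc (s ℕ.* 2)))) →
    length (stack {s = s} B C) ≡ length B ℕ.* q ^ s ℕ.+ length C
  length-stack {m} {s} B C = trans (List.length-++ (List.cartesianProductWith _ B (allVectors s)))
    (cong₂ ℕ._+_
      (trans (length-cartesianProductWith _ B (allVectors s)) (cong (length B ℕ.*_) (length-allVectors s)))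
      (List.length-map _ C))

  data Layer (B : List (Vector (suc m))) (C : List (Vector (suc (s ℕ.* 2)))) :
      Vector (suc (m ℕ.+ s ℕ.* 2)) → Set where
    new : ∀ {α r} (x : Vector s) → (α ∷ r) ∈ B → Layer B C (α ∷ r ++ par x)
    old : ∀ {α w} → (α ∷ w) ∈ C → Layer B C (α ∷ zeros m ++ w)

  ∈-stack⁻ : {B : List (Vector (suc m))} {C : List (Vector (suc (s ℕ.* 2)))} →
    ∀ {v} → v ∈ stack {s = s} B C → Layer {s = s} B C v
  ∈-stack⁻ {m} {s} {B} {C} v∈ with ∈-++⁻ (List.cartesianProductWith (λ p x → p ++ par x) B (allVectors s)) v∈
  ... | inj₁ v∈new with ∈-cartesianProductWith⁻ (λ p x → p ++ par x) B (allVectors s) v∈new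
  ...   | _ ∷ _ , x , p∈ , _ , refl = new x p∈
  ∈-stack⁻ {m} {s} {B} {C} v∈ | inj₂ v∈old with ∈-map⁻ _ v∈old
  ...   | _ ∷ _ , v∈C , refl = old v∈C

  ∈-stack⁺ : {B : List (Vector (suc m))} {C : List (Vector (suc (s ℕ.* 2)))} →
    ∀ {v} → Layer {s = s} B C v → v ∈ stack {s = s} B C
  ∈-stack⁺ (new x p∈) = ∈-++⁺ˡ (∈-cartesianProductWith⁺ (λ p x → p ++ par x) p∈ (∈-allVectors x))
  ∈-stack⁺ {m} {s} {B} (old v∈C) =
    ∈-++⁺ʳ (List.cartesianProductWith (λ p x → p ++ par x) B (allVectors s)) (∈-map⁺ _ v∈C)

  -- The conditions on c₁ and c₂ are those of `par-surjective`. The exceptional vectors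
  -- `α ∷ zeros m` are left to the smaller cap.
  Decomposes : List (Vector (suc m)) → Vector m → Carrier → Set
  Decomposes {m} B r α = r ≡ zeros m ⊎ ∃ λ p₁ → ∃ λ p₂ → ∃ λ c₁ → ∃ λ c₂ →
    p₁ ∈ B × p₂ ∈ B × c₁ ≢ 0# × c₂ ≢ 0# × c₁ ≢ c₂ × Dep c₁ c₂ 1# p₁ p₂ (α ∷ r)

  module Stacking (Critical : Carrier → Set) where

    -- A vector (α , w) with w = d · par x lies on a line joining two points of the next layer
    -- exactly when d is forbidden for α.
    Forbidden : (α d : Carrier) → Set
    Forbidden α d = α ≡ 0# ⊎ ∃ λ c → Critical c × d ≡ c * α

    -- Since par x + par y is par (x + y), this says that a multiple of a member never has second
    -- part d par t with d forbidden. The multiplier a stays explicit because relations are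
    -- homogeneous.
    Avoids : List (Vector (suc (s ℕ.* 2))) → Set
    Avoids {s} C = ∀ {α w a b} {x y : Vector s} → (α ∷ w) ∈ C → a ≢ 0# → Forbidden (a * α) b →
      Dep b b a (par x) (par y) w → ⊥

    -- The interface shared by the plane arc and the pair of affine points. `link` is the sum-point
    -- property of the direction `1# ∷ zeros m`: a join through it has equal coefficients, and their
    -- value is one that the smaller cap is built to avoid.
    record Base (B : List (Vector (suc m))) : Set where
      field
        isCap    : Cap B
        link     : ∀ {p₁ p₂ a b c α} → p₁ ∈ B → p₂ ∈ B → Dep a b c p₁ p₂ (α ∷ zeros m) →
                   a ≡ b × Forbidden (c * α) a
        isCovering : ∀ α r → Decomposes B r α

    module _ {B : List (Vector (suc m))} (base : Base B)
             {C : List (Vector (suc (s ℕ.* 2)))} (C-cap : Cap C) (C-avoids : Avoids {s} C) where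
      open Base base
      open Product isCap
      private
        module C = Cap C-cap

      private
        strip : ∀ {α α′ α″} {w w′ w″ : Vector (s ℕ.* 2)} →
          Dep a b c (α ∷ zeros m ++ w) (α′ ∷ zeros m ++ w′) (α″ ∷ zeros m ++ w″) →
          Dep a b c (α ∷ w) (α′ ∷ w′) (α″ ∷ w″)
        strip (e , d) = e , proj₂ (Dep-++⁻ (zeros m) (zeros m) (zeros m) d)

        pad : ∀ {α α′} {w w′ : Vector (s ℕ.* 2)} → α ∷ w ≡ α′ ∷ w′ →
          _≡_ {A = Vector (suc (m ℕ.+ s ℕ.* 2))} (α ∷ zeros m ++ w) (α′ ∷ zeros m ++ w′)
        pad refl = refl

        coincide-pad : ∀ {α α′ α″} {w w′ w″ : Vector (s ℕ.* 2)} →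
          Coincide a b c (α ∷ w) (α′ ∷ w′) (α″ ∷ w″) →
          Coincide a b c (α ∷ zeros m ++ w) (α′ ∷ zeros m ++ w′) (α″ ∷ zeros m ++ w″)
        coincide-pad (inj₁ e) = inj₁ (pad e)
        coincide-pad (inj₂ (inj₁ e)) = inj₂ (inj₁ (pad e))
        coincide-pad (inj₂ (inj₂ (inj₁ e))) = inj₂ (inj₂ (inj₁ (pad e)))
        coincide-pad (inj₂ (inj₂ (inj₂ t))) = inj₂ (inj₂ (inj₂ t))

        isolate : ∀ k (r : Vector k) → Dep a b c (zeros k) (zeros k) r → Dep c 0# c r r (zeros k)
        isolate zero [] d = tt
        isolate {a} {b} {c} (suc k) (x ∷ r) (e , d) =
          trans (solve 4 (λ a b c x → c :* x :+ con false :* x :+ c :* con false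
                            := a :* con false :+ b :* con false :+ c :* x) refl a b c x) e ,
          isolate k r d

        -- The hypothesis amounts to c r = 0, so c (α ∷ r) = c (α ∷ zeros m). Applying `link` to the
        -- member taken twice, with coefficients c and 0, makes these two equal. Thus no member of
        -- `B` lies in the exceptional direction.
        new-coefficient : ∀ {α r} → (α ∷ r) ∈ B → Dep a b c (zeros m) (zeros m) r → c ≡ 0#
        new-coefficient {c = c} {α} {r} n∈ d = proj₁ (link n∈ n∈
          (solve 2 (λ c x → c :* x :+ con false :* x :+ c :* x := con false) refl c α , isolate m r d))

        old-old-new : ∀ {α α′ α″ r} {w w′ : Vector (s ℕ.* 2)} {x : Vector s} →
          (α ∷ w) ∈ C → (α′ ∷ w′) ∈ C → (α″ ∷ r) ∈ B →
          Dep a b c (α ∷ zeros m ++ w) (α′ ∷ zeros m ++ w′) (α″ ∷ r ++ par x) →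
          Coincide a b c (α ∷ zeros m ++ w) (α′ ∷ zeros m ++ w′) (α″ ∷ r ++ par x)
        old-old-new {a} {b} {c} {α} {α′} {α″} {r} {w} {w′} o∈ o∈′ n∈ d
          with new-coefficient n∈ (proj₁ (Dep-++⁻ (zeros m) (zeros m) r (proj₂ d)))
        ... | refl with C.independent₂ o∈ o∈′ (strip (Dep-replace₃ (α ∷ zeros m ++ w) (α′ ∷ zeros m ++ w′) _ (α ∷ zeros m ++ w) d))
        ...   | inj₁ e = inj₁ (pad e)
        ...   | inj₂ (a≡0 , b≡0) = inj₂ (inj₂ (inj₂ (a≡0 , b≡0 , refl)))

        old-new : ∀ {α α′ r} {w : Vector (s ℕ.* 2)} {x : Vector s} {v} →
          (α ∷ w) ∈ C → (α′ ∷ r) ∈ B →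
          Dep a b 0# (α ∷ zeros m ++ w) (α′ ∷ r ++ par x) v → a ≡ 0# × b ≡ 0#
        old-new {α = α} {α′} {r} {w} {x} {v} o∈ n∈ d
          with d′ ← Dep-swap₂₃ (α ∷ zeros m ++ w) (α′ ∷ r ++ par x) (α ∷ zeros m ++ w)
                      (Dep-replace₃ (α ∷ zeros m ++ w) (α′ ∷ r ++ par x) v (α ∷ zeros m ++ w) d)
          with new-coefficient n∈ (proj₁ (Dep-++⁻ (zeros m) (zeros m) r (proj₂ d′)))
        ... | refl = C.independent₁ o∈ (strip (Dep-replace₂ (α ∷ zeros m ++ w) (α ∷ zeros m ++ w)
                       (α ∷ zeros m ++ w) (α′ ∷ r ++ par x) (α ∷ zeros m ++ w) d′)) , refl

        -- The only combination in which the layers can really meet. When c is not 0, `link` makes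
        -- the coefficients of the new points equal and forbidden, and the parabola part then
        -- contradicts `C-avoids`.
        new-new-old : ∀ {α α′ α″ r r′} {x y : Vector s} {w : Vector (s ℕ.* 2)} →
          (α ∷ r) ∈ B → (α′ ∷ r′) ∈ B → (α″ ∷ w) ∈ C →
          Dep a b c (α ∷ r ++ par x) (α′ ∷ r′ ++ par y) (α″ ∷ zeros m ++ w) →
          Coincide a b c (α ∷ r ++ par x) (α′ ∷ r′ ++ par y) (α″ ∷ zeros m ++ w)
        new-new-old {a} {b} {c} {α} {α′} {α″} {r} {r′} {x} {y} {w} n∈ n∈′ o∈ d with c ≟ 0#
        ... | yes refl with product₂ n∈ n∈′ d
        ...   | inj₁ e = inj₁ e
        ...   | inj₂ (a≡0 , b≡0) = inj₂ (inj₂ (inj₂ (a≡0 , b≡0 , refl)))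
        new-new-old {a} {b} {c} {α} {α′} {α″} {r} {r′} {x} {y} {w} n∈ n∈′ o∈ d | no c≢0
          with Dep-++⁻ (α ∷ r) (α′ ∷ r′) (α″ ∷ zeros m) {par x} {par y} {w} d
        ...   | d₁ , d₂ with link n∈ n∈′ d₁
        ...     | refl , forbidden = ⊥-elim (C-avoids {x = x} {y} o∈ c≢0 forbidden d₂)

        layer₃ : ∀ {u v w} → Layer {s = s} B C u → Layer {s = s} B C v → Layer {s = s} B C w →
          Dep a b c u v w → Coincide a b c u v w
        layer₃ (new x p∈) (new y p∈′) (new z p∈″) d = product₃ p∈ p∈′ p∈″ d
        layer₃ (new x p∈) (new y p∈′) (old o∈) d = new-new-old p∈ p∈′ o∈ d
        layer₃ {u = u} {v} {w} (new x p∈) (old o∈) (new y p∈′) d =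
          coincide-swap₂₃ (new-new-old p∈ p∈′ o∈ (Dep-swap₂₃ u v w d))
        layer₃ {u = u} {v} {w} (old o∈) (new x p∈) (new y p∈′) d =
          coincide-swap₁₂ (coincide-swap₂₃
            (new-new-old p∈ p∈′ o∈ (Dep-swap₂₃ v u w (Dep-swap₁₂ u v w d))))
        layer₃ (old o∈) (old o∈′) (new x p∈) d = old-old-new o∈ o∈′ p∈ d
        layer₃ {u = u} {v} {w} (old o∈) (new x p∈) (old o∈′) d =
          coincide-swap₂₃ (old-old-new o∈ o∈′ p∈ (Dep-swap₂₃ u v w d))
        layer₃ {u = u} {v} {w} (new x p∈) (old o∈) (old o∈′) d =
          coincide-swap₁₂ (coincide-swap₂₃
            (old-old-new o∈ o∈′ p∈ (Dep-swap₂₃ v u w (Dep-swap₁₂ u v w d))))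
        layer₃ (old o∈) (old o∈′) (old o∈″) d = coincide-pad (C.independent₃ o∈ o∈′ o∈″ (strip d))

        layer₂ : ∀ {u v w} → Layer {s = s} B C u → Layer {s = s} B C v →
          Dep a b 0# u v w → u ≡ v ⊎ (a ≡ 0# × b ≡ 0#)
        layer₂ (new x p∈) (new y p∈′) d = product₂ p∈ p∈′ d
        layer₂ {u = u} {v} {w} (old o∈) (old o∈′) d
          with C.independent₂ o∈ o∈′ (strip (Dep-replace₃ u v w v d))
        ... | inj₁ e = inj₁ (pad e)
        ... | inj₂ t = inj₂ t
        layer₂ (old o∈) (new x p∈) d = inj₂ (old-new o∈ p∈ d)
        layer₂ {u = u} {v} {w} (new x p∈) (old o∈) d =
          let b≡0 , a≡0 = old-new o∈ p∈ (Dep-swap₁₂ u v w d) in inj₂ (a≡0 , b≡0)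

        layer₁ : ∀ {u v w} → Layer {s = s} B C u → Dep a 0# 0# u v w → a ≡ 0#
        layer₁ (new x p∈) d = product₁ p∈ d
        layer₁ {u = u} {v} {w} (old o∈) d = C.independent₁ o∈ (strip (Dep-replace₂ u v u w u d))

      stack-cap : Cap (stack {s = s} B C)
      stack-cap = record
        { independent₁ = λ u∈ → layer₁ (∈-stack⁻ u∈)
        ; independent₂ = λ u∈ v∈ → layer₂ (∈-stack⁻ u∈) (∈-stack⁻ v∈)
        ; independent₃ = λ u∈ v∈ w∈ → layer₃ (∈-stack⁻ u∈) (∈-stack⁻ v∈) (∈-stack⁻ w∈)
        }

    -- A nonzero middle part r is reached by the products, a zero one is passed to `C`. The
    -- exception w = 0 lets the induction start from the empty list; these remaining vectors are
    -- covered only at the end, by `tower-covers-apex`.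
    stack-covers : {B : List (Vector (suc m))} → Base B →
      {C : List (Vector (suc (s ℕ.* 2)))} → (∀ α w → Covers C (α ∷ w) ⊎ w ≡ zeros (s ℕ.* 2)) →
      ∀ α w → Covers (stack {s = s} B C) (α ∷ w) ⊎ w ≡ zeros (m ℕ.+ s ℕ.* 2)
    stack-covers {m} {s} {B} base {C} C-covers α v with Vec.splitAt m v
    ... | r , w , refl with Base.isCovering base α r
    ...   | inj₂ (p₁@(_ ∷ _) , p₂@(_ ∷ _) , c₁ , c₂ , p₁∈ , p₂∈ , c₁≢0 , c₂≢0 , c₁≢c₂ , d)
      with par-surjective {s = s} c₁≢0 c₂≢0 c₁≢c₂ w
    ...     | x , y , d′ = inj₁ (p₁ ++ par x , p₂ ++ par y , c₁ , c₂ ,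
                ∈-stack⁺ (new x p₁∈) , ∈-stack⁺ (new y p₂∈) , Dep-++⁺ p₁ p₂ (α ∷ r) d d′)
    stack-covers {m} {s} {B} base {C} C-covers α v | r , w , refl | inj₁ refl with C-covers α w
    ... | inj₂ refl = inj₂ (zeros-++ m _)
    ... | inj₁ (u₁ ∷ us , v₁ ∷ vs , c₁ , c₂ , u∈ , v∈ , e , d) =
      inj₁ (u₁ ∷ zeros m ++ us , v₁ ∷ zeros m ++ vs , c₁ , c₂ , ∈-stack⁺ {s = s} {B} (old u∈) , ∈-stack⁺ {s = s} {B} (old v∈) ,
            e , Dep-++⁺ (zeros m) (zeros m) (zeros m) (Dep-zeros m) d)

    -- The tower of layers at infinity

    module Tower {T : List (Vector 3)} (base : Base T) (T-avoids : Avoids {1} T) where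

      tower : ∀ s → List (Vector (suc (s ℕ.* 2)))
      tower zero    = []
      tower (suc s) = stack {s = s} T (tower s)

      -- For a point of the newest layer the first block of w is the pair (β, γ) of its plane part,
      -- so `T-avoids` applies whatever the other blocks are. For an older point that block is zero
      -- and the remaining ones are handled by induction.
      tower-avoids : ∀ s → Avoids {s} (tower s)
      tower-avoids (suc s) {x = x ∷ xs} {y ∷ ys} v∈ a≢0 forbidden d with ∈-stack⁻ {m = 2} {s} {T} {tower s} v∈
      tower-avoids (suc s) {x = x ∷ xs} {y ∷ ys} v∈ a≢0 forbidden (e₁ , e₂ , d)
        | new {r = β ∷ γ ∷ []} z p∈ = T-avoids {x = x ∷ []} {y ∷ []} p∈ a≢0 forbidden (e₁ , e₂ , tt)
      tower-avoids (suc s) {x = x ∷ xs} {y ∷ ys} v∈ a≢0 forbidden (_ , _ , d)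
        | old o∈ = tower-avoids s {x = xs} {ys} o∈ a≢0 forbidden d

      tower-cap : ∀ s → Cap (tower s)
      tower-cap zero = record { independent₁ = λ () ; independent₂ = λ () ; independent₃ = λ () }
      tower-cap (suc s) = stack-cap {s = s} base (tower-cap s) (tower-avoids s)

      tower-covers : ∀ s α w → Covers (tower s) (α ∷ w) ⊎ w ≡ zeros (s ℕ.* 2)
      tower-covers zero    α [] = inj₂ refl
      tower-covers (suc s) = stack-covers {s = s} base (tower-covers s)

      length-tower : ∀ s → length (tower s) ≡ length T ℕ.* geomSum q s
      length-tower zero    = sym (ℕ.*-zeroʳ (length T))
      length-tower (suc s) = begin
        length (tower (suc s))                                ≡⟨ length-stack {s = s} T (tower s) ⟩
        length T ℕ.* q ^ s ℕ.+ length (tower s)               ≡⟨ cong (length T ℕ.* q ^ s ℕ.+_) (length-tower s) ⟩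
        length T ℕ.* q ^ s ℕ.+ length T ℕ.* geomSum q s       ≡⟨ ℕ.*-distribˡ-+ (length T) (q ^ s) (geomSum q s) ⟨
        length T ℕ.* geomSum q (suc s)                        ∎

      -- The affine layer

      module Full {c₀ θ : Carrier} (c₀≢0 : c₀ ≢ 0#) (critical : Critical c₀)
        (θ≢0 : θ ≢ 0#) (θ≢1 : θ ≢ 1#)
        {P₁ P₂ : Vector 3} (P₁∈ : P₁ ∈ T) (P₂∈ : P₂ ∈ T)
        (sum : Dep c₀ c₀ 1# P₁ P₂ (1# ∷ 0# ∷ 0# ∷ [])) where

        private
          -- Chosen so that (α, 0) = c₀α ((0, 1) + (δ, 1)): the direction joining the two affine
          -- points has the critical coefficient `c₀`, and what the tower avoids for the arc serves
          -- here as well.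
          δ : Carrier
          δ = inv c₀

          δ≢0 : δ ≢ 0#
          δ≢0 = inv-nonzero c₀≢0

          affine : Carrier → Vector 2
          affine x = x ∷ 1# ∷ []

          affinePair : List (Vector 2)
          affinePair = affine 0# ∷ affine δ ∷ []

          member : ∀ {p} → p ∈ affinePair → p ≡ affine 0# ⊎ p ≡ affine δ
          member (here e) = inj₁ e
          member (there (here e)) = inj₂ e

          coefficient-sum : ∀ x → a * 1# + b * 1# + c * x ≡ 0# → c * x ≡ 0# → a ≡ b
          coefficient-sum {a} {b} {c} x e e′ = +≡0⇒≡ (begin
            a + b                                ≡⟨ cong₂ _+_ (*-identityʳ a) (*-identityʳ b) ⟨
            a * 1# + b * 1#                      ≡⟨ +-identityʳ _ ⟨
            a * 1# + b * 1# + 0#                 ≡⟨ cong (a * 1# + b * 1# +_) e′ ⟨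
            a * 1# + b * 1# + c * x              ≡⟨ e ⟩
            0#                                   ∎)

          drop₁ : ∀ {x y z} → x * 0# + y + z ≡ 0# → y ≡ z
          drop₁ {x} {y} {z} e =
            +≡0⇒≡ (trans (solve 3 (λ x y z → y :+ z := x :* con false :+ y :+ z) refl x y z) e)

          drop₂ : ∀ {x y z} → x + y * 0# + z ≡ 0# → x ≡ z
          drop₂ {x} {y} {z} e =
            +≡0⇒≡ (trans (solve 3 (λ x y z → x :+ z := x :+ y :* con false :+ z) refl x y z) e)

          keep₁ : ∀ a v w → a ≡ a * 1# + 0# * v + 0# * w
          keep₁ = solve 3 (λ a v w → a := a :* con true :+ con false :* v :+ con false :* w) refl

          pair₁ : ∀ {u v w} → u ∈ affinePair → Dep a 0# 0# u v w → a ≡ 0#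
          pair₁ {a} {v = _ ∷ v ∷ []} {_ ∷ w ∷ []} u∈ d with member u∈
          ... | inj₁ refl = trans (keep₁ a v w) (proj₁ (proj₂ d))
          ... | inj₂ refl = trans (keep₁ a v w) (proj₁ (proj₂ d))

          pair₂ : ∀ {u v w} → u ∈ affinePair → v ∈ affinePair → Dep a b 0# u v w → u ≡ v ⊎ (a ≡ 0# × b ≡ 0#)
          pair₂ {w = w ∷ w′ ∷ []} u∈ v∈ d with member u∈ | member v∈
          ... | inj₁ refl | inj₁ refl = inj₁ refl
          ... | inj₂ refl | inj₂ refl = inj₁ refl
          pair₂ {a} {b} {w = w ∷ w′ ∷ []} u∈ v∈ (e₁ , e₂ , _) | inj₁ refl | inj₂ refl = inj₂ (trans a≡b b≡0 , b≡0)
            where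
            a≡b : a ≡ b
            a≡b = coefficient-sum w′ e₂ (zeroˡ w′)
            b≡0 : b ≡ 0#
            b≡0 = *-zero-cancel δ≢0 (trans (*-comm δ b) (trans (drop₁ e₁) (zeroˡ w)))
          pair₂ {a} {b} {w = w ∷ w′ ∷ []} u∈ v∈ (e₁ , e₂ , _) | inj₂ refl | inj₁ refl = inj₂ (a≡0 , trans (sym a≡b) a≡0)
            where
            a≡b : a ≡ b
            a≡b = coefficient-sum w′ e₂ (zeroˡ w′)
            a≡0 : a ≡ 0#
            a≡0 = *-zero-cancel δ≢0 (trans (*-comm δ a) (trans (drop₂ e₁) (zeroˡ w)))

          pair₃ : ∀ {u v w} → u ∈ affinePair → v ∈ affinePair → w ∈ affinePair → Coincide a b c u v w
          pair₃ u∈ v∈ w∈ with member u∈ | member v∈ | member w∈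
          ... | inj₁ refl | inj₁ refl | _ = inj₁ refl
          ... | inj₂ refl | inj₂ refl | _ = inj₁ refl
          ... | inj₁ refl | inj₂ refl | inj₁ refl = inj₂ (inj₁ refl)
          ... | inj₁ refl | inj₂ refl | inj₂ refl = inj₂ (inj₂ (inj₁ refl))
          ... | inj₂ refl | inj₁ refl | inj₁ refl = inj₂ (inj₂ (inj₁ refl))
          ... | inj₂ refl | inj₁ refl | inj₂ refl = inj₂ (inj₁ refl)

          undo-δ : ∀ {x y} → x * δ ≡ y → x ≡ c₀ * y
          undo-δ {x} {y} e = begin
            x             ≡⟨ *-inv-cancel c₀≢0 x ⟨
            c₀ * (δ * x)  ≡⟨ cong (c₀ *_) (trans (*-comm δ x) e) ⟩
            c₀ * y        ∎

          pair-link : ∀ {p₁ p₂} → p₁ ∈ affinePair → p₂ ∈ affinePair →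
            Dep a b c p₁ p₂ (α ∷ zeros 1) → a ≡ b × Forbidden (c * α) a
          pair-link p₁∈ p₂∈ d with member p₁∈ | member p₂∈
          pair-link {c = c} p₁∈ p₂∈ (e₁ , e₂ , _) | inj₁ refl | inj₁ refl
            with refl ← coefficient-sum 0# e₂ (zeroʳ c) =
            refl , inj₁ (sym (trans (sym (zeroʳ _)) (drop₁ e₁)))
          pair-link {a} {c = c} {α} p₁∈ p₂∈ (e₁ , e₂ , _) | inj₂ refl | inj₂ refl
            with refl ← coefficient-sum 0# e₂ (zeroʳ c) =
            refl , inj₁ (trans (solve 2 (λ x y → y := x :+ x :+ y) refl (a * δ) (c * α)) e₁)
          pair-link {c = c} p₁∈ p₂∈ (e₁ , e₂ , _) | inj₁ refl | inj₂ refl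
            with refl ← coefficient-sum 0# e₂ (zeroʳ c) =
            refl , inj₂ (c₀ , critical , undo-δ (drop₁ e₁))
          pair-link {c = c} p₁∈ p₂∈ (e₁ , e₂ , _) | inj₂ refl | inj₁ refl
            with refl ← coefficient-sum 0# e₂ (zeroʳ c) =
            refl , inj₂ (c₀ , critical , undo-δ (drop₂ e₁))

          t[1+θ]≢0 : ∀ {t} → t ≢ 0# → t * (1# + θ) ≢ 0#
          t[1+θ]≢0 t≢0 = *-nonzero t≢0 (θ≢1 ∘ sym ∘ +≡0⇒≡)

          tθ≢t[1+θ] : ∀ {t} → t ≢ 0# → t * θ ≢ t * (1# + θ)
          tθ≢t[1+θ] {t} t≢0 e = t≢0 (trans
            (solve 2 (λ t x → t := t :* x :+ t :* (con true :+ x)) refl t θ) (≡⇒+≡0 e))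

          -- For α = 0 or α = tδ the vector is a multiple of a single affine point, and its factor t
          -- is split as tθ + t(1 + θ) to get unequal coefficients. Otherwise the coefficients are
          -- solved for: c₀α at (δ, 1) and t + c₀α at (0, 1), which differ by t.
          pair-covering : ∀ α r → Decomposes affinePair r α
          pair-covering α (t ∷ []) with t ≟ 0#
          ... | yes refl = inj₁ refl
          ... | no t≢0 with α ≟ 0# | α ≟ (t * δ)
          ...   | yes refl | _ = inj₂ (affine 0# , affine 0# , t * θ , t * (1# + θ) , here refl , here refl ,
                  *-nonzero t≢0 θ≢0 , t[1+θ]≢0 t≢0 , tθ≢t[1+θ] t≢0 ,
                  solve 2 (λ t x → t :* x :* con false :+ t :* (con true :+ x) :* con false :+ con true :* con false := con false) refl t θ ,
                  solve 2 (λ t x → t :* x :* con true :+ t :* (con true :+ x) :* con true :+ con true :* t := con false) refl t θ , tt)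
          ...   | no _ | yes refl = inj₂ (affine δ , affine δ , t * θ , t * (1# + θ) , there (here refl) , there (here refl) ,
                  *-nonzero t≢0 θ≢0 , t[1+θ]≢0 t≢0 , tθ≢t[1+θ] t≢0 ,
                  solve 3 (λ t x d → t :* x :* d :+ t :* (con true :+ x) :* d :+ con true :* (t :* d) := con false) refl t θ δ ,
                  solve 2 (λ t x → t :* x :* con true :+ t :* (con true :+ x) :* con true :+ con true :* t := con false) refl t θ , tt)
          ...   | no α≢0 | no α≢tδ = inj₂ (affine 0# , affine δ , t + c₀ * α , c₀ * α , here refl , there (here refl) ,
                  (λ e → α≢tδ (sym (trans (cong (_* δ) (+≡0⇒≡ e)) c₀αδ))) ,
                  *-nonzero c₀≢0 α≢0 ,
                  (λ e → t≢0 (trans (solve 2 (λ t x → t := t :+ x :+ x) refl t (c₀ * α)) (≡⇒+≡0 e))) ,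
                  ≡⇒+≡0 (trans (cong₂ _+_ (zeroʳ _) c₀αδ) (trans (+-identityˡ α) (sym (*-identityˡ α)))) ,
                  solve 2 (λ t x → (t :+ x) :* con true :+ x :* con true :+ con true :* t := con false) refl t (c₀ * α) , tt)
            where
            c₀αδ : c₀ * α * δ ≡ α
            c₀αδ = trans (solve 3 (λ c x d → c :* x :* d := c :* (d :* x)) refl c₀ α δ) (*-inv-cancel c₀≢0 α)

          pair-base : Base affinePair
          pair-base = record
            { isCap = record { independent₁ = pair₁ ; independent₂ = pair₂ ; independent₃ = λ u∈ v∈ w∈ _ → pair₃ u∈ v∈ w∈ }
            ; link = pair-link
            ; isCovering = pair-covering
            }

          Dep-cancel : (u : Vector n) → Dep c c 1# u u (zeros n)
          Dep-cancel [] = tt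
          Dep-cancel {c = c} (x ∷ u) =
            solve 2 (λ c x → c :* x :+ c :* x :+ con true :* con false := con false) refl c x , Dep-cancel u

          scale-relation : ∀ {x y z} α → c₀ * x + c₀ * y + 1# * z ≡ 0# →
            α * c₀ * x + α * c₀ * y + 1# * (α * z) ≡ 0#
          scale-relation {x} {y} {z} α e = trans
            (solve 5 (λ α c x y z → α :* c :* x :+ α :* c :* y :+ con true :* (α :* z)
                        := α :* (c :* x :+ c :* y :+ con true :* z)) refl α c₀ x y z)
            (trans (cong (α *_) e) (zeroʳ α))

          -- Two points over the same parabola point, both with coefficient αc₀, cancel outside the
          -- plane and give α(1, 0, 0) inside it. This requires at least one layer, hence `suc s`.
          tower-covers-apex : ∀ {p₁ p₂} → p₁ ∈ T → p₂ ∈ T → Dep c₀ c₀ 1# p₁ p₂ (1# ∷ 0# ∷ 0# ∷ []) →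
            ∀ s α → Covers (tower (suc s)) (α ∷ zeros (suc s ℕ.* 2))
          tower-covers-apex {x₁ ∷ y₁ ∷ z₁ ∷ []} {x₂ ∷ y₂ ∷ z₂ ∷ []} p₁∈ p₂∈ (e₁ , e₂ , e₃ , _) s α =
            _ , _ , α * c₀ , α * c₀ , ∈-stack⁺ {m = 2} {s} {T} {tower s} (new (zeros s) p₁∈) ,
            ∈-stack⁺ {m = 2} {s} {T} {tower s} (new (zeros s) p₂∈) ,
            subst (λ z → α * c₀ * x₁ + α * c₀ * x₂ + 1# * z ≡ 0#) (*-identityʳ α) (scale-relation α e₁) ,
            subst (λ z → α * c₀ * y₁ + α * c₀ * y₂ + 1# * z ≡ 0#) (zeroʳ α) (scale-relation α e₂) ,
            subst (λ z → α * c₀ * z₁ + α * c₀ * z₂ + 1# * z ≡ 0#) (zeroʳ α) (scale-relation α e₃) ,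
            Dep-cancel (par (zeros s))

        full : ∀ s → List (Vector (2 ℕ.+ s ℕ.* 2))
        full s = stack {s = s} affinePair (tower s)

        full-cap : ∀ s → Cap (full s)
        full-cap s = stack-cap {s = s} pair-base (tower-cap s) (tower-avoids s)

        full-covers : ∀ s z → Covers (full (suc s)) z
        full-covers s (α ∷ w) with stack-covers {s = suc s} pair-base (tower-covers (suc s)) α w
        ... | inj₁ covered = covered
        ... | inj₂ refl with tower-covers-apex P₁∈ P₂∈ sum s α
        ...   | u₁ ∷ us , v₁ ∷ vs , c₁ , c₂ , u∈ , v∈ , e , d =
          _ , _ , c₁ , c₂ , ∈-stack⁺ {s = suc s} {affinePair} (old u∈) , ∈-stack⁺ {s = suc s} {affinePair} (old v∈) ,
          e , Dep-++⁺ (zeros 1) (zeros 1) (zeros 1) (Dep-zeros 1) d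

        length-full : ∀ s → length (full s) ≡ 2 ℕ.* q ^ s ℕ.+ length T ℕ.* geomSum q s
        length-full s = trans (length-stack {s = s} affinePair (tower s))
          (cong (2 ℕ.* q ^ s ℕ.+_) (length-tower s))

-- Normalized points

module Points {q : ℕ} (F : FiniteField q)
  (1+1≡0 : FiniteField._+_ F (FiniteField.1# F) (FiniteField.1# F) ≡ FiniteField.0# F) (n : ℕ) where
  open Linear F 1+1≡0 public
  open Geometry F n public

  infix 4 _≗?_
  _≗?_ : (u v : Vect) → Dec (u ≗ v)
  u ≗? v = all? (λ i → u i ≟ v i)

  ≗-sym : {u v : Vect} → u ≗ v → v ≗ u
  ≗-sym e i = sym (e i)

  ≗-trans : {u v w : Vect} → u ≗ v → v ≗ w → u ≗ w
  ≗-trans e e′ i = trans (e i) (e′ i)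

  Relation : (a b c : Carrier) (u v w : Vect) → Set
  Relation a b c u v w = ∀ i → a * u i + b * v i + c * w i ≡ 0#

  abstract
    solve-first : ∀ {a b c} P R S → a ≢ 0# → Relation a b c P R S →
      P ≗ (((inv a * b) · R) ⊕ ((inv a * c) · S))
    solve-first {a} {b} {c} P R S a≢0 e i = begin
      P i                                    ≡⟨ inv-*-cancel a≢0 (P i) ⟨
      inv a * (a * P i)                      ≡⟨ cong (inv a *_) (+≡0⇒≡ (trans (sym (+-assoc _ _ _)) (e i))) ⟩
      inv a * (b * R i + c * S i)            ≡⟨ distribˡ _ _ _ ⟩
      inv a * (b * R i) + inv a * (c * S i)  ≡⟨ cong₂ _+_ (*-assoc _ _ _) (*-assoc _ _ _) ⟨
      inv a * b * R i + inv a * c * S i      ∎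

    span₂ : ∀ {a b c} P R S → a ≢ 0# → Relation a b c P R S → OnLine P R S
    span₂ P R S a≢0 e = _ , _ , solve-first P R S a≢0 e

    normalized-nonzero : ∀ {v a} → Normalized v → (∀ i → a * v i ≡ 0#) → a ≡ 0#
    normalized-nonzero {v} {a} (i , one , _) e =
      trans (sym (*-identityʳ a)) (trans (cong (a *_) (sym one)) (e i))

    normalized-unique : ∀ {u v c} → Normalized u → Normalized v → u ≗ (c · v) → u ≗ v
    normalized-unique {u} {v} {c} (i , ui , u<) (j , vj , v<) e with <-cmp i j
    ... | tri< i<j _ _ = contradiction
            (trans (sym (zeroʳ c)) (trans (cong (c *_) (sym (v< i i<j))) (trans (sym (e i)) ui))) 0#≢1#
    ... | tri≈ _ refl _ = λ k → trans (e k) (trans (cong (_* v k) c≡1) (*-identityˡ (v k)))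
      where
      c≡1 : c ≡ 1#
      c≡1 = trans (sym (*-identityʳ c)) (trans (cong (c *_) (sym vj)) (trans (sym (e i)) ui))
    ... | tri> _ _ j<i = contradiction u≡0 λ u≡0 → 0#≢1# (trans (sym (u≡0 i)) ui)
      where
      c≡0 : c ≡ 0#
      c≡0 = trans (sym (*-identityʳ c)) (trans (cong (c *_) (sym vj)) (trans (sym (e j)) (u< j j<i)))
      u≡0 : ∀ k → u k ≡ 0#
      u≡0 k = trans (e k) (trans (cong (_* v k) c≡0) (zeroˡ (v k)))

    normalized-independent : ∀ {u v a b} → Normalized u → Normalized v →
      (∀ i → a * u i + b * v i ≡ 0#) → u ≗ v ⊎ (a ≡ 0# × b ≡ 0#)
    normalized-independent {u} {v} {a} {b} nu nv e with a ≟ 0#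
    ... | no a≢0 = inj₁ (normalized-unique {c = inv a * b} nu nv λ i →
            trans (sym (inv-*-cancel a≢0 (u i))) (trans (cong (inv a *_) (+≡0⇒≡ (e i))) (sym (*-assoc _ _ _))))
    ... | yes refl = inj₂ (refl , normalized-nonzero nv λ i →
            trans (sym (trans (cong (_+ b * v i) (zeroˡ (u i))) (+-identityˡ _))) (e i))

  leading : ∀ {k} (v : Fin k → Carrier) →
    (∃ λ i → v i ≢ 0# × (∀ j → j Fin.< i → v j ≡ 0#)) ⊎ (∀ i → v i ≡ 0#)
  leading {zero}  v = inj₂ λ ()
  leading {suc k} v with v zero ≟ 0#
  ... | no v₀≢0 = inj₁ (zero , v₀≢0 , λ _ ())
  ... | yes v₀≡0 with leading (v ∘ suc)
  ...   | inj₁ (i , vi≢0 , before) =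
            inj₁ (suc i , vi≢0 , λ { zero _ → v₀≡0 ; (suc j) (s≤s j<i) → before j j<i })
  ...   | inj₂ v≡0 = inj₂ λ { zero → v₀≡0 ; (suc i) → v≡0 i }

  abstract
    -- The value 1 at the zero vector keeps `scalar-nonzero` free of hypotheses.
    scalar : Vect → Carrier
    scalar v with leading v
    ... | inj₁ (i , _) = inv (v i)
    ... | inj₂ _       = 1#

    scalar-nonzero : ∀ v → scalar v ≢ 0#
    scalar-nonzero v with leading v
    ... | inj₁ (i , vi≢0 , _) = inv-nonzero vi≢0
    ... | inj₂ _              = 0#≢1# ∘ sym

    scalar-normalizes : ∀ v → ¬ (∀ i → v i ≡ 0#) → Normalized (scalar v · v)
    scalar-normalizes v v≢0 with leading v
    ... | inj₁ (i , vi≢0 , before) =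
            i , *-invˡ vi≢0 , λ j j<i → trans (cong (inv (v i) *_) (before j j<i)) (zeroʳ _)
    ... | inj₂ v≡0 = contradiction v≡0 v≢0

  normalize : Vect → Vect
  normalize v = scalar v · v

  -- Since the size is only bounded from above, repetitions may simply be removed, and the
  -- constructed lists never have to be shown free of them.
  dedupe : List Vect → List Vect
  dedupe [] = []
  dedupe (v ∷ K) with Any.any? (_≗? v) (dedupe K)
  ... | yes _ = dedupe K
  ... | no _  = v ∷ dedupe K

  length-dedupe : ∀ K → length (dedupe K) ≤ length K
  length-dedupe [] = z≤n
  length-dedupe (v ∷ K) with Any.any? (_≗? v) (dedupe K)
  ... | yes _ = ℕ.m≤n⇒m≤1+n (length-dedupe K)
  ... | no _  = s≤s (length-dedupe K)

  ∈-dedupe⁻ : ∀ K {v} → v ∈ dedupe K → v ∈ K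
  ∈-dedupe⁻ (v ∷ K) v∈ with Any.any? (_≗? v) (dedupe K)
  ∈-dedupe⁻ (v ∷ K) v∈         | yes _ = there (∈-dedupe⁻ K v∈)
  ∈-dedupe⁻ (v ∷ K) (here e)   | no _  = here e
  ∈-dedupe⁻ (v ∷ K) (there v∈) | no _  = there (∈-dedupe⁻ K v∈)

  ∈-dedupe⁺ : ∀ K {v} → v ∈ K → v ∈ₚ dedupe K
  ∈-dedupe⁺ (v ∷ K) v∈ with Any.any? (_≗? v) (dedupe K)
  ∈-dedupe⁺ (v ∷ K) (here refl) | yes found = found
  ∈-dedupe⁺ (v ∷ K) (there v∈)  | yes _     = ∈-dedupe⁺ K v∈
  ∈-dedupe⁺ (v ∷ K) (here refl) | no _      = here λ _ → refl
  ∈-dedupe⁺ (v ∷ K) (there v∈)  | no _      = there (∈-dedupe⁺ K v∈)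

  dedupe-distinct : ∀ K → Distinct (dedupe K)
  dedupe-distinct [] = tt
  dedupe-distinct (v ∷ K) with Any.any? (_≗? v) (dedupe K)
  ... | yes _    = dedupe-distinct K
  ... | no fresh = ¬Any⇒All¬ _ fresh , dedupe-distinct K

  Dep-lookup : ∀ {k a b c} (u v w : Vector k) → Dep a b c u v w →
    ∀ i → a * lookup u i + b * lookup v i + c * lookup w i ≡ 0#
  Dep-lookup (x ∷ u) (y ∷ v) (z ∷ w) (e , d) zero    = e
  Dep-lookup (x ∷ u) (y ∷ v) (z ∷ w) (e , d) (suc i) = Dep-lookup u v w d i

  lookup-Dep : ∀ {k a b c} (u v w : Vector k) →
    (∀ i → a * lookup u i + b * lookup v i + c * lookup w i ≡ 0#) → Dep a b c u v w
  lookup-Dep [] [] [] e = tt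
  lookup-Dep (x ∷ u) (y ∷ v) (z ∷ w) e = e zero , lookup-Dep u v w (e ∘ suc)

  -- From covering caps of vectors to complete caps of points

  module Completion {L : List (Vector (suc n))} (L-cap : Cap L) (L-covers : ∀ z → Covers L z) where
    open Cap L-cap

    point : Vector (suc n) → Vect
    point u = normalize (lookup u)

    points : List Vect
    points = dedupe (List.map point L)

    private
      factor : Vector (suc n) → Carrier
      factor u = scalar (lookup u)

      factor-nonzero : ∀ u → factor u ≢ 0#
      factor-nonzero u = scalar-nonzero (lookup u)

      point-normalized : ∀ {u} → u ∈ L → Normalized (point u)
      point-normalized {u} u∈ = scalar-normalizes (lookup u) λ u≡0 →
        0#≢1# (sym (independent₁ u∈ (lookup-Dep u u u λ i →
          trans (solve 1 (λ x → con true :* x :+ con false :* x :+ con false :* x := x) refl (lookup u i)) (u≡0 i))))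

      origin : ∀ {P} → P ∈ₚ points → ∃ λ u → u ∈ L × P ≗ point u
      origin P∈ with find P∈
      ... | R , R∈ , R≗P with ∈-map⁻ point (∈-dedupe⁻ (List.map point L) R∈)
      ...   | u , u∈ , refl = u , u∈ , ≗-sym R≗P

      point∈ : ∀ {u} → u ∈ L → point u ∈ₚ points
      point∈ u∈ = ∈-dedupe⁺ (List.map point L) (∈-map⁺ point u∈)

      pull : ∀ {P u} a → P ≗ point u → ∀ i → a * P i ≡ (a * factor u) * lookup u i
      pull a e i = trans (cong (a *_) (e i)) (sym (*-assoc _ _ _))

      cancel-factor : ∀ {a} u → a * factor u ≡ 0# → a ≡ 0#
      cancel-factor u e = *-zero-cancel (factor-nonzero u) (trans (*-comm _ _) e)

      no-three : ∀ P Q R → P ∈ₚ points → Q ∈ₚ points → R ∈ₚ points →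
        ¬ (P ≗ Q) → ¬ (P ≗ R) → ¬ (Q ≗ R) → ¬ Collinear P Q R
      no-three P Q R P∈ Q∈ R∈ P≢Q P≢R Q≢R (a , b , c , nontrivial , e)
        with origin P∈ | origin Q∈ | origin R∈
      ... | u , u∈ , P≗u | v , v∈ , Q≗v | w , w∈ , R≗w
        with independent₃ u∈ v∈ w∈ (lookup-Dep u v w λ i →
               trans (sym (cong₂ _+_ (cong₂ _+_ (pull {u = u} a P≗u i) (pull {u = v} b Q≗v i)) (pull {u = w} c R≗w i))) (e i))
      ... | inj₁ refl = P≢Q (≗-trans P≗u (≗-sym Q≗v))
      ... | inj₂ (inj₁ refl) = P≢R (≗-trans P≗u (≗-sym R≗w))
      ... | inj₂ (inj₂ (inj₁ refl)) = Q≢R (≗-trans Q≗v (≗-sym R≗w))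
      ... | inj₂ (inj₂ (inj₂ (e₁ , e₂ , e₃))) =
              nontrivial (cancel-factor u e₁ , cancel-factor v e₂ , cancel-factor w e₃)

      points-cap : IsCap points
      points-cap = All.tabulate normalized , dedupe-distinct (List.map point L) , no-three
        where
        normalized : ∀ {P} → P ∈ points → Normalized P
        normalized P∈ with ∈-map⁻ point (∈-dedupe⁻ (List.map point L) P∈)
        ... | u , u∈ , refl = point-normalized u∈

      -- The covering pair is rescaled to normalized points P and R. If these agree, Z is
      -- proportional to a point of the cap and so equal to it; if not, Z, P and R are three
      -- collinear points.
      maximal : ∀ Z → Normalized Z → ¬ (Z ∈ₚ points) → ¬ IsCap (Z ∷ points)
      maximal Z nZ Z∉ (_ , _ , no-three′) with L-covers (tabulate Z)
      ... | u , v , c₁ , c₂ , u∈ , v∈ , d = ⊥-elim conclusion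
        where
        P R : Vect
        P = point u
        R = point v

        b c : Carrier
        b = c₁ * inv (factor u)
        c = c₂ * inv (factor v)

        unscale : ∀ w c x → c * inv (factor w) * (factor w * x) ≡ c * x
        unscale w c x = trans (*-assoc _ _ _) (cong (c *_) (inv-*-cancel (factor-nonzero w) x))

        relation : ∀ i → 1# * Z i + b * P i + c * R i ≡ 0#
        relation i = begin
          1# * Z i + b * P i + c * R i
            ≡⟨ cong₂ _+_ (cong₂ _+_ (cong (1# *_) (sym (lookup∘tabulate Z i))) (unscale u c₁ (lookup u i))) (unscale v c₂ (lookup v i)) ⟩
          1# * lookup (tabulate Z) i + c₁ * lookup u i + c₂ * lookup v i
            ≡⟨ solve 3 (λ x y z → x :+ y :+ z := y :+ z :+ x) refl _ _ _ ⟩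
          c₁ * lookup u i + c₂ * lookup v i + 1# * lookup (tabulate Z) i
            ≡⟨ Dep-lookup u v (tabulate Z) d i ⟩
          0# ∎

        Z≢ : ∀ {S} → S ∈ₚ points → ¬ (Z ≗ S)
        Z≢ S∈ Z≗S = Z∉ (Any.map (λ e → ≗-trans e (≗-sym Z≗S)) S∈)

        Z≗multiple : P ≗ R → Z ≗ ((b + c) · P)
        Z≗multiple P≗R i = +≡0⇒≡ (begin
          Z i + (b + c) * P i            ≡⟨ solve 4 (λ z b c p → z :+ (b :+ c) :* p := con true :* z :+ b :* p :+ c :* p) refl _ _ _ _ ⟩
          1# * Z i + b * P i + c * P i   ≡⟨ cong (λ x → 1# * Z i + b * P i + c * x) (P≗R i) ⟩
          1# * Z i + b * P i + c * R i   ≡⟨ relation i ⟩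
          0#                             ∎)

        conclusion : ⊥
        conclusion with P ≗? R
        ... | yes P≗R = Z≢ (point∈ u∈) (normalized-unique nZ (point-normalized u∈) (Z≗multiple P≗R))
        ... | no P≢R = no-three′ Z P R (here λ _ → refl) (there (point∈ u∈)) (there (point∈ v∈))
                (Z≢ (point∈ u∈)) (Z≢ (point∈ v∈)) P≢R
                (1# , b , c , (λ { (e , _) → 0#≢1# (sym e) }) , relation)

    complete : IsCompleteCap points
    complete = points-cap , maximal

    length-points : length points ≤ length L
    length-points = ℕ.≤-trans (length-dedupe (List.map point L)) (ℕ.≤-reflexive (List.length-map point L))

∈-pairs : {A : Set} {xs : List A} {x y : A} → x ∈ xs → y ∈ xs →
  x ≡ y ⊎ (x , y) ∈ pairs xs ⊎ (y , x) ∈ pairs xs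
∈-pairs (here refl) (here refl) = inj₁ refl
∈-pairs (here refl) (there y∈) = inj₂ (inj₁ (∈-++⁺ˡ (∈-map⁺ _ y∈)))
∈-pairs (there x∈) (here refl) = inj₂ (inj₂ (∈-++⁺ˡ (∈-map⁺ _ x∈)))
∈-pairs {xs = z ∷ xs} (there x∈) (there y∈) with ∈-pairs x∈ y∈
... | inj₁ e = inj₁ e
... | inj₂ (inj₁ p) = inj₂ (inj₁ (∈-++⁺ʳ (List.map (z ,_) xs) p))
... | inj₂ (inj₂ p) = inj₂ (inj₂ (∈-++⁺ʳ (List.map (z ,_) xs) p))

-- Independence, extension and secants of a cap

module CapPoints {q : ℕ} (F : FiniteField q)
  (1+1≡0 : FiniteField._+_ F (FiniteField.1# F) (FiniteField.1# F) ≡ FiniteField.0# F) (n : ℕ)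
  {K : List (Geometry.Vect F n)} (K-cap : Geometry.IsCap F n K) where
  open Points F 1+1≡0 n

  abstract
    ∈⇒∈ₚ : ∀ {P} → P ∈ K → P ∈ₚ K
    ∈⇒∈ₚ = Any.map λ { refl _ → refl }

    normalized : ∀ {P} → P ∈ K → Normalized P
    normalized = All.lookup (proj₁ K-cap)

  private
    Relation-resp : ∀ {a b c P R S P′ R′ S′} → P ≗ P′ → R ≗ R′ → S ≗ S′ →
      Relation a b c P R S → Relation a b c P′ R′ S′
    Relation-resp {a} {b} {c} p r s e i =
      trans (sym (cong₂ _+_ (cong₂ _+_ (cong (a *_) (p i)) (cong (b *_) (r i))) (cong (c *_) (s i)))) (e i)

  abstract
    -- Deciding the equalities turns the negative statement that no three distinct points are
    -- collinear into a list of cases to match on.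
    independent : ∀ {a b c P R S} → P ∈ K → R ∈ K → S ∈ K → Relation a b c P R S →
      P ≗ R ⊎ P ≗ S ⊎ R ≗ S ⊎ Trivial a b c
    independent {a} {b} {c} {P} {R} {S} P∈ R∈ S∈ e
      with P ≗? R | P ≗? S | R ≗? S | (a ≟ 0#) ×-dec (b ≟ 0#) ×-dec (c ≟ 0#)
    ... | yes p | _     | _     | _ = inj₁ p
    ... | no _  | yes p | _     | _ = inj₂ (inj₁ p)
    ... | no _  | no _  | yes p | _ = inj₂ (inj₂ (inj₁ p))
    ... | no _  | no _  | no _  | yes t = inj₂ (inj₂ (inj₂ t))
    ... | no x  | no y  | no z  | no nontrivial =
      ⊥-elim (proj₂ (proj₂ K-cap) P R S (∈⇒∈ₚ P∈) (∈⇒∈ₚ R∈) (∈⇒∈ₚ S∈) x y z (a , b , c , nontrivial , e))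

  module Extend {Z : Vect} (Z-normalized : Normalized Z) (Z∉K : ¬ (Z ∈ₚ K))
    (free : ∀ {P R} → P ∈ K → R ∈ K → ¬ OnLine Z P R) where

    private
      free₃ : ∀ {a b c Z′ P R} → Z ≗ Z′ → P ∈ₚ K → R ∈ₚ K → ¬ (P ≗ R) →
        ¬ Trivial a b c → ¬ Relation a b c Z′ P R
      free₃ {a} {b} {c} Z≗ P∈ R∈ P≢R nontrivial e with find P∈ | find R∈
      ... | P′ , P′∈ , P′≗P | R′ , R′∈ , R′≗R
        with e′ ← Relation-resp (≗-sym Z≗) (≗-sym P′≗P) (≗-sym R′≗R) e | a ≟ 0#
      ...   | no a≢0 = free P′∈ R′∈ (span₂ Z P′ R′ a≢0 e′)
      ...   | yes refl with normalized-independent (normalized P′∈) (normalized R′∈)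
                (λ i → trans (cong (_+ c * R′ i) (sym (trans (cong (_+ b * P′ i) (zeroˡ (Z i))) (+-identityˡ _)))) (e′ i))
      ...     | inj₁ P′≗R′ = P≢R (≗-trans (≗-sym P′≗P) (≗-trans P′≗R′ R′≗R))
      ...     | inj₂ (b≡0 , c≡0) = nontrivial (refl , b≡0 , c≡0)

      swap₁₂ : ∀ {a b c P R S} → Relation a b c P R S → Relation b a c R P S
      swap₁₂ {c = c} {S = S} e i = trans (cong (_+ c * S i) (+-comm _ _)) (e i)

      rotate : ∀ {a b c P R S} → Relation a b c P R S → Relation c a b S P R
      rotate {a} {b} {c} {P} {R} {S} e i = trans (trans (+-assoc _ _ _) (+-comm _ _)) (e i)

      no-three : ∀ P R S → P ∈ₚ (Z ∷ K) → R ∈ₚ (Z ∷ K) → S ∈ₚ (Z ∷ K) →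
        ¬ (P ≗ R) → ¬ (P ≗ S) → ¬ (R ≗ S) → ¬ Collinear P R S
      no-three P R S (here p) (here r) _ P≢R P≢S R≢S _ = P≢R (≗-trans (≗-sym p) r)
      no-three P R S (here p) (there _) (here s) P≢R P≢S R≢S _ = P≢S (≗-trans (≗-sym p) s)
      no-three P R S (there _) (here r) (here s) P≢R P≢S R≢S _ = R≢S (≗-trans (≗-sym r) s)
      no-three P R S (here p) (there r) (there s) P≢R P≢S R≢S (a , b , c , nontrivial , e) =
        free₃ p r s R≢S nontrivial e
      no-three P R S (there p) (here r) (there s) P≢R P≢S R≢S (a , b , c , nontrivial , e) =
        free₃ r p s P≢S (λ { (x , y , z) → nontrivial (y , x , z) }) (swap₁₂ {P = P} {R} {S} e)
      no-three P R S (there p) (there r) (here s) P≢R P≢S R≢S (a , b , c , nontrivial , e) =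
        free₃ s p r P≢R (λ { (z , x , y) → nontrivial (x , y , z) }) (rotate {P = P} {R} {S} e)
      no-three P R S (there p) (there r) (there s) = proj₂ (proj₂ K-cap) P R S p r s

    extended-cap : IsCap (Z ∷ K)
    extended-cap = Z-normalized ∷ proj₁ K-cap , (¬Any⇒All¬ K Z∉K , proj₁ (proj₂ K-cap)) , no-three

  module Maximal (maximal : ∀ Z → Normalized Z → ¬ (Z ∈ₚ K) → ¬ IsCap (Z ∷ K)) where

    abstract
      -- Completeness only denies that Z can be added. The points of a secant are found by searching
      -- K twice; a failed search makes `Z ∷ K` a cap.
      secant : ∀ {Z} → Normalized Z → ¬ (Z ∈ₚ K) → ∃ λ P → ∃ λ R → P ∈ K × R ∈ K × OnLine Z P R
      secant {Z} nZ Z∉ with Any.any? (λ P → Any.any? (λ R → onLine? Z P R) K) K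
      ... | yes found with find found
      ...   | P , P∈ , found′ with find found′
      ...     | R , R∈ , on = P , R , P∈ , R∈ , on
      secant {Z} nZ Z∉ | no none = ⊥-elim (maximal Z nZ Z∉
        (Extend.extended-cap nZ Z∉ λ P∈ R∈ on → none (lose P∈ (lose R∈ on))))

    spanned : ∀ {Z} → Normalized Z → ∃ λ P → ∃ λ R → P ∈ K × R ∈ K × OnLine Z P R
    spanned {Z} nZ with Any.any? (_≗? Z) K
    ... | no Z∉ = secant nZ Z∉
    ... | yes Z∈ with find Z∈
    ...   | P , P∈ , P≗Z = P , P , P∈ , P∈ , 1# , 0# , λ i →
      trans (sym (P≗Z i)) (solve 1 (λ x → x := con true :* x :+ con false :* x) refl (P i))

-- Coordinates in the plane

module Frames {q : ℕ} (F : FiniteField q)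
  (1+1≡0 : FiniteField._+_ F (FiniteField.1# F) (FiniteField.1# F) ≡ FiniteField.0# F) where
  open Points F 1+1≡0 2

  det : Vect → Vect → Vect → Carrier
  det u v w = u 0F * (v 1F * w 2F + v 2F * w 1F)
            + u 1F * (v 2F * w 0F + v 0F * w 2F)
            + u 2F * (v 0F * w 1F + v 1F * w 0F)

  unit : Fin 3 → Vect
  unit 0F 0F = 1#
  unit 1F 1F = 1#
  unit 2F 2F = 1#
  unit _  _  = 0#

  unit-normalized : ∀ k → Normalized (unit k)
  unit-normalized 0F = 0F , refl , λ _ ()
  unit-normalized 1F = 1F , refl , λ { 0F _ → refl ; (suc _) (s≤s ()) }
  unit-normalized 2F = 2F , refl , λ { 0F _ → refl ; 1F _ → refl ; 2F (s≤s (s≤s ())) }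

  private
    cramer-identity : ∀ {n} → Fin 3 → (p₀ p₁ p₂ u₀ u₁ u₂ v₀ v₁ v₂ w₀ w₁ w₂ : Polynomial n) →
      Polynomial n × Polynomial n
    cramer-identity {n} i p₀ p₁ p₂ u₀ u₁ u₂ v₀ v₁ v₂ w₀ w₁ w₂ =
      d p₀ p₁ p₂ v₀ v₁ v₂ w₀ w₁ w₂ :* component i u₀ u₁ u₂
        :+ d u₀ u₁ u₂ p₀ p₁ p₂ w₀ w₁ w₂ :* component i v₀ v₁ v₂
        :+ d u₀ u₁ u₂ v₀ v₁ v₂ p₀ p₁ p₂ :* component i w₀ w₁ w₂
      := d u₀ u₁ u₂ v₀ v₁ v₂ w₀ w₁ w₂ :* component i p₀ p₁ p₂
      where
      component : Fin 3 → (x₀ x₁ x₂ : Polynomial n) → Polynomial n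
      component 0F x₀ x₁ x₂ = x₀
      component 1F x₀ x₁ x₂ = x₁
      component 2F x₀ x₁ x₂ = x₂

      d : (x₀ x₁ x₂ y₀ y₁ y₂ z₀ z₁ z₂ : Polynomial n) → Polynomial n
      d x₀ x₁ x₂ y₀ y₁ y₂ z₀ z₁ z₂ =
        x₀ :* (y₁ :* z₂ :+ y₂ :* z₁) :+ x₁ :* (y₂ :* z₀ :+ y₀ :* z₂) :+ x₂ :* (y₀ :* z₁ :+ y₁ :* z₀)

  abstract
    -- Cramer's rule without division, so it is available when the determinant vanishes;
    -- `det-nonzero` uses it in that case.
    cramer : ∀ P u v w i → det P v w * u i + det u P w * v i + det u v P * w i ≡ det u v w * P i
    cramer P u v w 0F = solve 12 (cramer-identity 0F) refl (P 0F) (P 1F) (P 2F)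
      (u 0F) (u 1F) (u 2F) (v 0F) (v 1F) (v 2F) (w 0F) (w 1F) (w 2F)
    cramer P u v w 1F = solve 12 (cramer-identity 1F) refl (P 0F) (P 1F) (P 2F)
      (u 0F) (u 1F) (u 2F) (v 0F) (v 1F) (v 2F) (w 0F) (w 1F) (w 2F)
    cramer P u v w 2F = solve 12 (cramer-identity 2F) refl (P 0F) (P 1F) (P 2F)
      (u 0F) (u 1F) (u 2F) (v 0F) (v 1F) (v 2F) (w 0F) (w 1F) (w 2F)

    -- That `unit 2F` lies on AB makes the first 2 by 2 minor of A and B vanish, while the
    -- representations of `unit 0F` and `unit 1F` make a multiple of that minor equal to 1.
    two-do-not-span : ∀ A B → ¬ (∀ k → OnLine (unit k) A B)
    two-do-not-span A B spans with spans 0F | spans 1F | spans 2F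
    ... | a₀ , b₀ , e₀ | a₁ , b₁ , e₁ | a₂ , b₂ , e₂ = 0#≢1# (begin
      0#                                             ≡⟨ zeroʳ _ ⟨
      (a₀ * b₁ + a₁ * b₀) * 0#                       ≡⟨ cong ((a₀ * b₁ + a₁ * b₀) *_) minor≡0 ⟨
      (a₀ * b₁ + a₁ * b₀) * (A 0F * B 1F + A 1F * B 0F)
        ≡⟨ solve 8 (λ a b c d x y z w → (a :* d :+ c :* b) :* (x :* w :+ y :* z)
             := (a :* x :+ b :* z) :* (c :* y :+ d :* w) :+ (a :* y :+ b :* w) :* (c :* x :+ d :* z))
             refl a₀ b₀ a₁ b₁ (A 0F) (A 1F) (B 0F) (B 1F) ⟩
      (a₀ * A 0F + b₀ * B 0F) * (a₁ * A 1F + b₁ * B 1F) + (a₀ * A 1F + b₀ * B 1F) * (a₁ * A 0F + b₁ * B 0F)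
        ≡⟨ cong₂ _+_ (cong₂ _*_ (e₀ 0F) (e₁ 1F)) (cong₂ _*_ (e₀ 1F) (e₁ 0F)) ⟨
      1# * 1# + 0# * 0#                              ≡⟨ solve 0 (con true :* con true :+ con false :* con false := con true) refl ⟩
      1#                                             ∎)
      where
      minor≡0 : A 0F * B 1F + A 1F * B 0F ≡ 0#
      minor≡0 = begin
        A 0F * B 1F + A 1F * B 0F
          ≡⟨ solve 6 (λ x₀ x₁ x₂ y₀ y₁ y₂ → x₀ :* y₁ :+ x₁ :* y₀
               := con false :* (x₁ :* y₂ :+ x₂ :* y₁) :+ con false :* (x₂ :* y₀ :+ x₀ :* y₂) :+ con true :* (x₀ :* y₁ :+ x₁ :* y₀))
               refl (A 0F) (A 1F) (A 2F) (B 0F) (B 1F) (B 2F) ⟩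
        det (unit 2F) A B
          ≡⟨ cong₂ _+_ (cong₂ _+_ (cong (_* _) (e₂ 0F)) (cong (_* _) (e₂ 1F))) (cong (_* _) (e₂ 2F)) ⟩
        det ((a₂ · A) ⊕ (b₂ · B)) A B
          ≡⟨ solve 8 (λ a b x₀ x₁ x₂ y₀ y₁ y₂ →
               (a :* x₀ :+ b :* y₀) :* (x₁ :* y₂ :+ x₂ :* y₁)
               :+ (a :* x₁ :+ b :* y₁) :* (x₂ :* y₀ :+ x₀ :* y₂)
               :+ (a :* x₂ :+ b :* y₂) :* (x₀ :* y₁ :+ x₁ :* y₀) := con false)
               refl a₂ b₂ (A 0F) (A 1F) (A 2F) (B 0F) (B 1F) (B 2F) ⟩
        0# ∎

  private
    abstract
      regroup : ∀ a b c x₁ x₂ x₃ y₁ y₂ y₃ z₁ z₂ z₃ s t r →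
        (a * x₁ + b * x₂ + c * x₃) * s + (a * y₁ + b * y₂ + c * y₃) * t + (a * z₁ + b * z₂ + c * z₃) * r ≡
        a * (x₁ * s + y₁ * t + z₁ * r) + b * (x₂ * s + y₂ * t + z₂ * r) + c * (x₃ * s + y₃ * t + z₃ * r)
      regroup = solve 15 (λ a b c x₁ x₂ x₃ y₁ y₂ y₃ z₁ z₂ z₃ s t r →
        (a :* x₁ :+ b :* x₂ :+ c :* x₃) :* s :+ (a :* y₁ :+ b :* y₂ :+ c :* y₃) :* t :+ (a :* z₁ :+ b :* z₂ :+ c :* z₃) :* r :=
        a :* (x₁ :* s :+ y₁ :* t :+ z₁ :* r) :+ b :* (x₂ :* s :+ y₂ :* t :+ z₂ :* r) :+ c :* (x₃ :* s :+ y₃ :* t :+ z₃ :* r)) refl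

  module Frame {Q A B : Vect} (nA : Normalized A) (nB : Normalized B) (A≢B : ¬ (A ≗ B))
    (off : ¬ OnLine Q A B) where

    abstract
      frame-independent : ∀ {a b c} → Relation a b c Q A B → Trivial a b c
      frame-independent {a} {b} {c} e with a ≟ 0#
      ... | no a≢0 = contradiction (span₂ Q A B a≢0 e) off
      ... | yes refl with normalized-independent nA nB
              (λ i → trans (cong (_+ c * B i) (sym (trans (cong (_+ b * A i) (zeroˡ (Q i))) (+-identityˡ _)))) (e i))
      ...   | inj₁ A≗B = contradiction A≗B A≢B
      ...   | inj₂ (b≡0 , c≡0) = refl , b≡0 , c≡0

      -- With a zero determinant, `cramer` applied to each unit vector is a relation among Q, A and
      -- B. Its coefficients at Q, the 2 by 2 minors of A and B, must vanish, and then A and B are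
      -- proportional.
      det-nonzero : det Q A B ≢ 0#
      det-nonzero D≡0 = A≢B (≗-sym (normalized-unique nB nA proportional))
        where
        cofactor : ∀ k → det (unit k) A B ≡ 0#
        cofactor k = proj₁ (frame-independent λ i →
          trans (cramer (unit k) Q A B i) (trans (cong (_* unit k i) D≡0) (zeroˡ _)))

        minor : ∀ i j → A i * B j ≡ A j * B i
        minor 0F 0F = refl
        minor 1F 1F = refl
        minor 2F 2F = refl
        minor 1F 2F = +≡0⇒≡ (trans (solve 3 (λ x y z → x := con true :* x :+ con false :* y :+ con false :* z) refl _ _ _) (cofactor 0F))
        minor 2F 0F = +≡0⇒≡ (trans (solve 3 (λ x y z → y := con false :* x :+ con true :* y :+ con false :* z) refl _ _ _) (cofactor 1F))
        minor 0F 1F = +≡0⇒≡ (trans (solve 3 (λ x y z → z := con false :* x :+ con false :* y :+ con true :* z) refl _ _ _) (cofactor 2F))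
        minor 2F 1F = sym (minor 1F 2F)
        minor 0F 2F = sym (minor 2F 0F)
        minor 1F 0F = sym (minor 0F 1F)

        pivot : Fin 3
        pivot = proj₁ nA

        proportional : B ≗ (B pivot · A)
        proportional j = begin
          B j              ≡⟨ *-identityˡ _ ⟨
          1# * B j         ≡⟨ cong (_* B j) (proj₁ (proj₂ nA)) ⟨
          A pivot * B j    ≡⟨ minor pivot j ⟩
          A j * B pivot    ≡⟨ *-comm _ _ ⟩
          B pivot * A j    ∎

      ξ η ζ : Vect → Carrier
      ξ P = inv (det Q A B) * det P A B
      η P = inv (det Q A B) * det Q P B
      ζ P = inv (det Q A B) * det Q A P

      expand : ∀ P i → P i ≡ ξ P * Q i + η P * A i + ζ P * B i
      expand P i = begin
        P i                                     ≡⟨ inv-*-cancel det-nonzero (P i) ⟨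
        inv D * (D * P i)                       ≡⟨ cong (inv D *_) (cramer P Q A B i) ⟨
        inv D * (det P A B * Q i + det Q P B * A i + det Q A P * B i)
          ≡⟨ solve 7 (λ d x y z s t r → d :* (x :* s :+ y :* t :+ z :* r)
                        := d :* x :* s :+ d :* y :* t :+ d :* z :* r) refl _ _ _ _ _ _ _ ⟩
        ξ P * Q i + η P * A i + ζ P * B i       ∎
        where
        D : Carrier
        D = det Q A B

      relation-coordinates : ∀ {a b c P R S} → Relation a b c P R S →
        (a * ξ P + b * ξ R + c * ξ S ≡ 0#) ×
        (a * η P + b * η R + c * η S ≡ 0#) ×
        (a * ζ P + b * ζ R + c * ζ S ≡ 0#)
      relation-coordinates {a} {b} {c} {P} {R} {S} e = frame-independent λ i → begin
        (a * ξ P + b * ξ R + c * ξ S) * Q i + (a * η P + b * η R + c * η S) * A i + (a * ζ P + b * ζ R + c * ζ S) * B i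
          ≡⟨ regroup a b c (ξ P) (ξ R) (ξ S) (η P) (η R) (η S) (ζ P) (ζ R) (ζ S) (Q i) (A i) (B i) ⟩
        a * (ξ P * Q i + η P * A i + ζ P * B i) + b * (ξ R * Q i + η R * A i + ζ R * B i) + c * (ξ S * Q i + η S * A i + ζ S * B i)
          ≡⟨ cong₂ _+_ (cong₂ _+_ (cong (a *_) (expand P i)) (cong (b *_) (expand R i))) (cong (c *_) (expand S i)) ⟨
        a * P i + b * R i + c * S i ≡⟨ e i ⟩
        0# ∎

      coordinates-relation : ∀ {a b c P R S} →
        a * ξ P + b * ξ R + c * ξ S ≡ 0# → a * η P + b * η R + c * η S ≡ 0# → a * ζ P + b * ζ R + c * ζ S ≡ 0# →
        Relation a b c P R S
      coordinates-relation {a} {b} {c} {P} {R} {S} e₁ e₂ e₃ i = begin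
        a * P i + b * R i + c * S i
          ≡⟨ cong₂ _+_ (cong₂ _+_ (cong (a *_) (expand P i)) (cong (b *_) (expand R i))) (cong (c *_) (expand S i)) ⟩
        a * (ξ P * Q i + η P * A i + ζ P * B i) + b * (ξ R * Q i + η R * A i + ζ R * B i) + c * (ξ S * Q i + η S * A i + ζ S * B i)
          ≡⟨ regroup a b c (ξ P) (ξ R) (ξ S) (η P) (η R) (η S) (ζ P) (ζ R) (ζ S) (Q i) (A i) (B i) ⟨
        (a * ξ P + b * ξ R + c * ξ S) * Q i + (a * η P + b * η R + c * η S) * A i + (a * ζ P + b * ζ R + c * ζ S) * B i
          ≡⟨ cong₂ _+_ (cong₂ _+_ (cong (_* Q i) e₁) (cong (_* A i) e₂)) (cong (_* B i) e₃) ⟩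
        0# * Q i + 0# * A i + 0# * B i
          ≡⟨ solve 3 (λ x y z → con false :* x :+ con false :* y :+ con false :* z := con false) refl _ _ _ ⟩
        0# ∎

      coordinates-unique : ∀ {P x y z} → (∀ i → P i ≡ x * Q i + y * A i + z * B i) →
        ξ P ≡ x × η P ≡ y × ζ P ≡ z
      coordinates-unique {P} {x} {y} {z} e =
        let e₁ , e₂ , e₃ = frame-independent {ξ P + x} {η P + y} {ζ P + z} λ i → (begin
              (ξ P + x) * Q i + (η P + y) * A i + (ζ P + z) * B i
                ≡⟨ solve 9 (λ a x b y c z s t r → (a :+ x) :* s :+ (b :+ y) :* t :+ (c :+ z) :* r
                     := (a :* s :+ b :* t :+ c :* r) :+ (x :* s :+ y :* t :+ z :* r)) refl _ _ _ _ _ _ _ _ _ ⟩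
              (ξ P * Q i + η P * A i + ζ P * B i) + (x * Q i + y * A i + z * B i)
                ≡⟨ ≡⇒+≡0 (trans (sym (expand P i)) (e i)) ⟩
              0# ∎)
        in +≡0⇒≡ e₁ , +≡0⇒≡ e₂ , +≡0⇒≡ e₃

-- The arc and its sum-point

module SumPoint {q : ℕ} (F : FiniteField q)
  (1+1≡0 : FiniteField._+_ F (FiniteField.1# F) (FiniteField.1# F) ≡ FiniteField.0# F)
  {K : List (Geometry.Vect F 2)} {Q : Geometry.Vect F 2}
  (K-complete : Geometry.IsCompleteCap F 2 K) (Q-unique : Geometry.HasUniqueSumPoint F 2 K Q) where

  open Points F 1+1≡0 2
  open Frames F 1+1≡0
  private
    module KP = CapPoints F 1+1≡0 2 (proj₁ K-complete)
  open KP.Maximal (proj₂ K-complete)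

  Q-normalized : Normalized Q
  Q-normalized = proj₁ (proj₁ Q-unique)

  Q∉K : ¬ (Q ∈ₚ K)
  Q∉K = proj₁ (proj₂ (proj₁ Q-unique))

  equal-coefficients : ∀ {P R c₁ c₂} → P ∈ K → R ∈ K → ¬ (P ≗ R) → Q ≗ ((c₁ · P) ⊕ (c₂ · R)) → c₁ ≡ c₂
  equal-coefficients P∈ R∈ P≢R = proj₂ (proj₂ (proj₁ Q-unique)) _ _ (KP.∈⇒∈ₚ P∈) (KP.∈⇒∈ₚ R∈) P≢R _ _

  Q≢ : ∀ {P} → P ∈ K → ¬ (P ≗ Q)
  Q≢ P∈ P≗Q = Q∉K (lose P∈ P≗Q)

  record Secant : Set where
    field
      {P R} : Vect
      {c}   : Carrier
      P∈    : P ∈ K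
      R∈    : R ∈ K
      P≢R   : ¬ (P ≗ R)
      c≢0   : c ≢ 0#
      sum   : Q ≗ ((c · P) ⊕ (c · R))

  abstract
    Q-secant : Secant
    Q-secant with secant Q-normalized Q∉K
    ... | P , R , P∈ , R∈ , c₁ , c₂ , e with P ≗? R
    ...   | yes P≗R = contradiction (≗-sym (normalized-unique Q-normalized (KP.normalized P∈) multiple)) (Q≢ P∈)
      where
      multiple : Q ≗ ((c₁ + c₂) · P)
      multiple i = trans (e i) (trans (cong (λ z → c₁ * P i + c₂ * z) (sym (P≗R i))) (sym (distribʳ (P i) c₁ c₂)))
    ...   | no P≢R with equal-coefficients P∈ R∈ P≢R e
    ...     | refl = record { P∈ = P∈ ; R∈ = R∈ ; P≢R = P≢R ; c≢0 = c≢0 ; sum = e }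
      where
      c≢0 : c₁ ≢ 0#
      c≢0 refl = 0#≢1# (sym (normalized-nonzero Q-normalized λ i →
        trans (*-identityˡ (Q i)) (trans (e i)
          (solve 2 (λ x y → con false :* x :+ con false :* y := con false) refl (P i) (R i)))))

  -- The remaining points are listed as `first ∷ others` because their number must be positive: this
  -- is half of the reason for q > 2.
  record SecantFrame : Set where
    field
      A B    : Vect
      A∈     : A ∈ K
      B∈     : B ∈ K
      A≢B    : ¬ (A ≗ B)
      off    : ¬ OnLine Q A B
      first  : Vect
      others : List Vect
      size   : length K ≡ 2 ℕ.+ length (first ∷ others)
      rest   : ∀ {P} → P ∈ K → P ≡ A ⊎ P ≡ B ⊎ P ∈ first ∷ others

  private
    -- Completeness expresses every point of the plane by two points of K, so with K inside a pair
    -- the whole plane would lie on one line.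
    not-within-two : ∀ A B → ¬ (∀ {P} → P ∈ K → P ≡ A ⊎ P ≡ B)
    not-within-two A B within = two-do-not-span A B λ k → on-AB k (spanned (unit-normalized k))
      where
      split : ∀ x y c → c * x ≡ c * x + 0# * y
      split x y c = solve 3 (λ x y c → c :* x := c :* x :+ con false :* y) refl x y c

      as-pair : ∀ {P} → P ∈ K → ∀ c → ∃ λ a → ∃ λ b → ∀ i → c * P i ≡ a * A i + b * B i
      as-pair P∈ c with within P∈
      ... | inj₁ refl = c , 0# , λ i → split (A i) (B i) c
      ... | inj₂ refl = 0# , c , λ i → trans (split (B i) (A i) c) (+-comm _ _)

      on-AB : ∀ k → (∃ λ P → ∃ λ R → P ∈ K × R ∈ K × OnLine (unit k) P R) → OnLine (unit k) A B
      on-AB k (P , R , P∈ , R∈ , c₁ , c₂ , e) with as-pair P∈ c₁ | as-pair R∈ c₂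
      ... | a , b , e₁ | a′ , b′ , e₂ = a + a′ , b + b′ , λ i → begin
        unit k i                                     ≡⟨ e i ⟩
        c₁ * P i + c₂ * R i                          ≡⟨ cong₂ _+_ (e₁ i) (e₂ i) ⟩
        (a * A i + b * B i) + (a′ * A i + b′ * B i)
          ≡⟨ solve 6 (λ a b c d x y → (a :* x :+ b :* y) :+ (c :* x :+ d :* y)
               := (a :+ c) :* x :+ (b :+ d) :* y) refl a b a′ b′ (A i) (B i) ⟩
        (a + a′) * A i + (b + b′) * B i              ∎

    -- From Q = b(A + B) = c(A + C) follows (b + c)A + bB + cC = 0, impossible in an arc. So of AB
    -- and AC at least one misses Q.
    off-second : ∀ {A B C} → A ∈ K → B ∈ K → C ∈ K → ¬ (A ≗ B) → ¬ (A ≗ C) → ¬ (B ≗ C) →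
      OnLine Q A B → ¬ OnLine Q A C
    off-second {A} {B} {C} A∈ B∈ C∈ A≢B A≢C B≢C (b , b′ , e) (c , c′ , e′)
      with equal-coefficients A∈ B∈ A≢B e | equal-coefficients A∈ C∈ A≢C e′
    ... | refl | refl with KP.independent {b + c} {b} {c} A∈ B∈ C∈ (λ i → begin
        (b + c) * A i + b * B i + c * C i
          ≡⟨ solve 5 (λ b c x y z → (b :+ c) :* x :+ b :* y :+ c :* z := (b :* x :+ b :* y) :+ (c :* x :+ c :* z))
               refl b c (A i) (B i) (C i) ⟩
        (b * A i + b * B i) + (c * A i + c * C i)   ≡⟨ ≡⇒+≡0 (trans (sym (e i)) (e′ i)) ⟩
        0#                                          ∎)
    ...   | inj₁ A≗B = A≢B A≗B
    ...   | inj₂ (inj₁ A≗C) = A≢C A≗C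
    ...   | inj₂ (inj₂ (inj₁ B≗C)) = B≢C B≗C
    ...   | inj₂ (inj₂ (inj₂ (_ , refl , _))) = 0#≢1# (sym (normalized-nonzero Q-normalized λ i →
              trans (*-identityˡ (Q i)) (trans (e i)
                (solve 2 (λ x y → con false :* x :+ con false :* y := con false) refl (A i) (B i)))))

    frame-from : ∀ L → K ≡ L → Distinct L → SecantFrame
    frame-from [] refl _ = ⊥-elim (not-within-two Q Q λ ())
    frame-from (A ∷ []) refl _ = ⊥-elim (not-within-two A A λ { (here e) → inj₁ e })
    frame-from (A ∷ B ∷ []) refl _ =
      ⊥-elim (not-within-two A B λ { (here e) → inj₁ e ; (there (here e)) → inj₂ e })
    frame-from (A ∷ B ∷ C ∷ L) refl (B≢A ∷ C≢A ∷ _ , (C≢B ∷ _) , _) with onLine? Q A B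
    ... | no off = record
      { A = A ; B = B ; A∈ = here refl ; B∈ = there (here refl) ; A≢B = B≢A ∘ ≗-sym ; off = off
      ; first = C ; others = L ; size = refl
      ; rest = λ { (here e) → inj₁ e ; (there (here e)) → inj₂ (inj₁ e) ; (there (there P∈)) → inj₂ (inj₂ P∈) }
      }
    ... | yes on = record
      { A = A ; B = C ; A∈ = here refl ; B∈ = there (there (here refl)) ; A≢B = C≢A ∘ ≗-sym
      ; off = off-second (here refl) (there (here refl)) (there (there (here refl)))
                (B≢A ∘ ≗-sym) (C≢A ∘ ≗-sym) (C≢B ∘ ≗-sym) on
      ; first = B ; others = L ; size = refl
      ; rest = λ { (here e) → inj₁ e ; (there (here e)) → inj₂ (inj₂ (here e))
                 ; (there (there (here e))) → inj₂ (inj₁ e) ; (there (there (there P∈))) → inj₂ (inj₂ (there P∈)) }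
      }

  abstract
    secantFrame : SecantFrame
    secantFrame = frame-from K refl (proj₁ (proj₂ (proj₁ K-complete)))

  abstract
    -- Either coefficient would do, as the two agree on a secant through a sum-point. The default 0
    -- is never taken on `secantPairs`.
    coefficient : Vect × Vect → Carrier
    coefficient (P , R) with onLine? Q P R
    ... | yes (c , _) = c
    ... | no _        = 0#

    secantPairs : List (Vect × Vect)
    secantPairs = List.filter (λ pr → onLine? Q (proj₁ pr) (proj₂ pr)) (pairs K)

    coefficients : List Carrier
    coefficients = List.map coefficient secantPairs

    length-coefficients : length coefficients ≡ secantsThrough K Q
    length-coefficients = List.length-map coefficient secantPairs

    private
      coefficient-unique : ∀ {P R c} → P ∈ K → R ∈ K → ¬ (P ≗ R) → Q ≗ ((c · P) ⊕ (c · R)) → coefficient (P , R) ≡ c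
      coefficient-unique {P} {R} {c} P∈ R∈ P≢R e with onLine? Q P R
      ... | no off = contradiction (c , c , e) off
      ... | yes (c₁ , c₂ , e′) with normalized-independent {a = c₁ + c} {c₂ + c} (KP.normalized P∈) (KP.normalized R∈)
              (λ i → trans (solve 5 (λ a b c x y → (a :+ c) :* x :+ (b :+ c) :* y := (a :* x :+ b :* y) :+ (c :* x :+ c :* y))
                              refl c₁ c₂ c (P i) (R i))
                           (≡⇒+≡0 (trans (sym (e′ i)) (e i))))
      ...   | inj₁ P≗R = contradiction P≗R P≢R
      ...   | inj₂ (c₁≡c , _) = +≡0⇒≡ c₁≡c

    ∈-coefficients : ∀ {P R c} → P ∈ K → R ∈ K → ¬ (P ≗ R) → Q ≗ ((c · P) ⊕ (c · R)) → c ∈ coefficients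
    ∈-coefficients {P} {R} {c} P∈ R∈ P≢R e with ∈-pairs P∈ R∈
    ... | inj₁ refl = contradiction (λ _ → refl) P≢R
    ... | inj₂ (inj₁ PR∈) = subst (_∈ coefficients) (coefficient-unique P∈ R∈ P≢R e)
            (∈-map⁺ coefficient (∈-filter⁺ _ PR∈ (c , c , e)))
    ... | inj₂ (inj₂ RP∈) = subst (_∈ coefficients) (coefficient-unique R∈ P∈ (P≢R ∘ ≗-sym) e′)
            (∈-map⁺ coefficient (∈-filter⁺ _ RP∈ (c , c , e′)))
      where
      e′ : Q ≗ ((c · R) ⊕ (c · P))
      e′ i = trans (e i) (+-comm _ _)

  -- Q being the only sum-point, every other point gets a representation with distinct coefficients.
  Unequal : Vect → Set
  Unequal Z = ∃ λ P → ∃ λ R → P ∈ K × R ∈ K × ∃ λ c₁ → ∃ λ c₂ →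
    c₁ ≢ 0# × c₂ ≢ 0# × c₁ ≢ c₂ × Z ≗ ((c₁ · P) ⊕ (c₂ · R))

  private
    -- Coefficients are replaced by their positions in the enumeration, which makes the existence of
    -- an unequal representation decidable by finite search.
    UnequalIndices : Vect → Vect → Vect → Set
    UnequalIndices Z P R = ∃ λ i → ∃ λ j → element i ≢ 0# × element j ≢ 0# × element i ≢ element j ×
      Z ≗ ((element i · P) ⊕ (element j · R))

    unequalIndices? : ∀ Z P R → Dec (UnequalIndices Z P R)
    unequalIndices? Z P R = any? λ i → any? λ j →
      ¬? (element i ≟ 0#) ×-dec ¬? (element j ≟ 0#) ×-dec ¬? (element i ≟ element j) ×-dec
      (Z ≗? ((element i · P) ⊕ (element j · R)))

    unequalIndices : ∀ {Z P R c₁ c₂} → c₁ ≢ 0# → c₂ ≢ 0# → c₁ ≢ c₂ → Z ≗ ((c₁ · P) ⊕ (c₂ · R)) →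
      UnequalIndices Z P R
    unequalIndices {Z} {P} {R} {c₁} {c₂} c₁≢0 c₂≢0 c₁≢c₂ e
      with position c₁ | position c₂ | element-position c₁ | element-position c₂
    ... | i | j | refl | refl = i , j , c₁≢0 , c₂≢0 , c₁≢c₂ , e

  abstract
    -- If no unequal representation exists, Z is a sum-point and uniqueness gives Q. It is outside K
    -- because P = θP + (1 + θ)P would be such a representation; a representation with one zero
    -- coefficient would put Z into K.
    unequal-or-Q : ∀ {θ} → θ ≢ 0# → θ ≢ 1# → ∀ {Z} → Normalized Z → Unequal Z ⊎ Z ≗ Q
    unequal-or-Q {θ} θ≢0 θ≢1 {Z} nZ with Any.any? (λ P → Any.any? (λ R → unequalIndices? Z P R) K) K
    ... | yes found with find found
    ...   | P , P∈ , found′ with find found′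
    ...     | R , R∈ , i , j , i≢0 , j≢0 , i≢j , e =
                inj₁ (P , R , P∈ , R∈ , element i , element j , i≢0 , j≢0 , i≢j , e)
    unequal-or-Q {θ} θ≢0 θ≢1 {Z} nZ | no none = inj₂ (proj₂ Q-unique Z (nZ , Z∉K , equal))
      where
      never : ∀ {P R c₁ c₂} → P ∈ K → R ∈ K → c₁ ≢ 0# → c₂ ≢ 0# → c₁ ≢ c₂ → ¬ (Z ≗ ((c₁ · P) ⊕ (c₂ · R)))
      never P∈ R∈ c₁≢0 c₂≢0 c₁≢c₂ e = none (lose P∈ (lose R∈ (unequalIndices c₁≢0 c₂≢0 c₁≢c₂ e)))

      Z∉K : ¬ (Z ∈ₚ K)
      Z∉K Z∈ with find Z∈
      ... | P , P∈ , P≗Z = never {c₁ = θ} {1# + θ} P∈ P∈ θ≢0 (θ≢1 ∘ sym ∘ +≡0⇒≡)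
        (λ θ≡1+θ → 0#≢1# (sym (trans (solve 1 (λ x → con true := x :+ (con true :+ x)) refl θ) (≡⇒+≡0 θ≡1+θ))))
        (λ i → trans (sym (P≗Z i)) (solve 2 (λ x t → x := t :* x :+ (con true :+ t) :* x) refl (P i) θ))

      on-K : ∀ {P c} → P ∈ₚ K → ¬ (Z ≗ (c · P))
      on-K P∈ Z≗cP with find P∈
      ... | P′ , P′∈ , P′≗P = Z∉K (lose P′∈ (≗-sym (normalized-unique nZ (KP.normalized P′∈)
        λ i → trans (Z≗cP i) (cong (_ *_) (sym (P′≗P i))))))

      equal : ∀ P R → P ∈ₚ K → R ∈ₚ K → ¬ (P ≗ R) → ∀ c₁ c₂ → Z ≗ ((c₁ · P) ⊕ (c₂ · R)) → c₁ ≡ c₂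
      equal P R P∈ R∈ P≢R c₁ c₂ e = decidable-stable (c₁ ≟ c₂) λ c₁≢c₂ → impossible c₁≢c₂
        where
        impossible : c₁ ≢ c₂ → ⊥
        impossible c₁≢c₂ with c₁ ≟ 0# | c₂ ≟ 0#
        ... | yes refl | _ = on-K R∈ λ i → trans (e i) (trans (cong (_+ c₂ * R i) (zeroˡ (P i))) (+-identityˡ _))
        ... | no _ | yes refl = on-K P∈ λ i → trans (e i) (trans (cong (c₁ * P i +_) (zeroˡ (R i))) (+-identityʳ _))
        ... | no c₁≢0 | no c₂≢0 with find P∈ | find R∈
        ...   | P′ , P′∈ , P′≗P | R′ , R′∈ , R′≗R = never P′∈ R′∈ c₁≢0 c₂≢0 c₁≢c₂
                  λ i → trans (e i) (cong₂ _+_ (cong (c₁ *_) (sym (P′≗P i))) (cong (c₂ *_) (sym (R′≗R i))))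

  -- The arc in rescaled coordinates

  module Scaled {A B : Vect} (A∈ : A ∈ K) (B∈ : B ∈ K) (A≢B : ¬ (A ≗ B)) (off : ¬ OnLine Q A B)
    (remaining : List Vect) (rest : ∀ {P} → P ∈ K → P ≡ A ⊎ P ≡ B ⊎ P ∈ remaining) where

    open Frame (KP.normalized A∈) (KP.normalized B∈) A≢B off

    -- The values of μ for which some (ξ , η , μ ζ) satisfies μ ζ ξ c = η².
    excluded : List Carrier
    excluded = List.cartesianProductWith (λ P c → η P * η P * inv (c * ξ P * ζ P)) remaining coefficients

    length-excluded : length excluded ≡ length remaining ℕ.* secantsThrough K Q
    length-excluded = trans (length-cartesianProductWith _ remaining coefficients)
      (cong (length remaining ℕ.*_) length-coefficients)

    module _ {μ θ : Carrier} (μ≢0 : μ ≢ 0#) (μ∉excluded : ¬ (μ ∈ excluded))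
      (θ≢0 : θ ≢ 0#) (θ≢1 : θ ≢ 1#) where

      open Stacking (_∈ coefficients)

      coords : Vect → Vector 3
      coords P = ξ P ∷ η P ∷ μ * ζ P ∷ []

      coordsK : List (Vector 3)
      coordsK = List.map coords K

      private
        abstract
          scale : ∀ a b c x y z → μ * (a * x + b * y + c * z) ≡ a * (μ * x) + b * (μ * y) + c * (μ * z)
          scale a b c x y z = solve 7 (λ m a b c x y z → m :* (a :* x :+ b :* y :+ c :* z)
            := a :* (m :* x) :+ b :* (m :* y) :+ c :* (m :* z)) refl μ a b c x y z

      abstract
        relation⇒Dep : ∀ {a b c} P R S → Relation a b c P R S → Dep a b c (coords P) (coords R) (coords S)
        relation⇒Dep {a} {b} {c} P R S e =
          let e₁ , e₂ , e₃ = relation-coordinates {P = P} {R} {S} e in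
          e₁ , e₂ , trans (sym (scale a b c (ζ P) (ζ R) (ζ S))) (trans (cong (μ *_) e₃) (zeroʳ μ)) , tt

        Dep⇒relation : ∀ {a b c} P R S → Dep a b c (coords P) (coords R) (coords S) → Relation a b c P R S
        Dep⇒relation {a} {b} {c} P R S (e₁ , e₂ , e₃ , _) = coordinates-relation {P = P} {R} {S} e₁ e₂
          (*-zero-cancel μ≢0 (trans (scale a b c (ζ P) (ζ R) (ζ S)) e₃))

        coords-unique : ∀ {P x y z} → (∀ i → P i ≡ x * Q i + y * A i + z * B i) → coords P ≡ x ∷ y ∷ μ * z ∷ []
        coords-unique {P} e with coordinates-unique {P} e
        ... | e₁ , e₂ , e₃ = cong₂ _∷_ e₁ (cong₂ _∷_ e₂ (cong (λ z → μ * z ∷ []) e₃))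

        coords-cong : ∀ {P R} → P ≗ R → coords P ≡ coords R
        coords-cong {P} {R} e = coords-unique λ i → trans (e i) (expand R i)

        coords-multiple : ∀ α → coords (α · Q) ≡ α ∷ zeros 2
        coords-multiple α = trans
          (coords-unique {x = α} {0#} {0#} λ i →
            solve 3 (λ x y z → x := x :+ con false :* y :+ con false :* z) refl (α * Q i) (A i) (B i))
          (cong (λ z → α ∷ 0# ∷ z ∷ []) (zeroʳ μ))

      private
        origin : ∀ {u} → u ∈ coordsK → ∃ λ P → P ∈ K × u ≡ coords P
        origin = ∈-map⁻ coords

        abstract
          only₁ : ∀ {a} P R S → Relation a 0# 0# P R S → ∀ i → a * P i ≡ 0#
          only₁ {a} P R S e i = trans
            (solve 3 (λ x y z → x := x :+ con false :* y :+ con false :* z) refl (a * P i) (R i) (S i)) (e i)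

          only₂ : ∀ {a b} P R S → Relation a b 0# P R S → ∀ i → a * P i + b * R i ≡ 0#
          only₂ {a} {b} P R S e i = trans
            (solve 2 (λ x z → x := x :+ con false :* z) refl (a * P i + b * R i) (S i)) (e i)

        cap₁ : ∀ {a u v w} → u ∈ coordsK → Dep a 0# 0# u v w → a ≡ 0#
        cap₁ {v = v} {w} u∈ d with origin u∈
        ... | P , P∈ , refl = normalized-nonzero (KP.normalized P∈)
          (only₁ P P P (Dep⇒relation P P P (Dep-replace₂ (coords P) v (coords P) w (coords P) d)))

        cap₂ : ∀ {a b u v w} → u ∈ coordsK → v ∈ coordsK → Dep a b 0# u v w → u ≡ v ⊎ (a ≡ 0# × b ≡ 0#)
        cap₂ {w = w} u∈ v∈ d with origin u∈ | origin v∈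
        ... | P , P∈ , refl | R , R∈ , refl
          with normalized-independent (KP.normalized P∈) (KP.normalized R∈)
                 (only₂ P R P (Dep⇒relation P R P (Dep-replace₃ (coords P) (coords R) w (coords P) d)))
        ...   | inj₁ P≗R = inj₁ (coords-cong P≗R)
        ...   | inj₂ t = inj₂ t

        cap₃ : ∀ {a b c u v w} → u ∈ coordsK → v ∈ coordsK → w ∈ coordsK → Dep a b c u v w → Coincide a b c u v w
        cap₃ u∈ v∈ w∈ d with origin u∈ | origin v∈ | origin w∈
        ... | P , P∈ , refl | R , R∈ , refl | S , S∈ , refl
          with KP.independent P∈ R∈ S∈ (Dep⇒relation P R S d)
        ...   | inj₁ e = inj₁ (coords-cong e)
        ...   | inj₂ (inj₁ e) = inj₂ (inj₁ (coords-cong e))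
        ...   | inj₂ (inj₂ (inj₁ e)) = inj₂ (inj₂ (inj₁ (coords-cong e)))
        ...   | inj₂ (inj₂ (inj₂ t)) = inj₂ (inj₂ (inj₂ t))

        -- If P = R, then a + b and e vanish because P is not Q. If P and R differ and e = 0, both
        -- coefficients vanish. Otherwise division by e represents Q on a secant, so the sum-point
        -- property gives a = b, with a / e in `coefficients`.
        link-points : ∀ {a b e P R} → P ∈ K → R ∈ K → (∀ i → e * Q i + a * P i + b * R i ≡ 0#) →
          a ≡ b × Forbidden e a
        link-points {a} {b} {e} {P} {R} P∈ R∈ rel with P ≗? R
        ... | yes P≗R with normalized-independent {a = a + b} {e} (KP.normalized P∈) Q-normalized (λ i → begin
                (a + b) * P i + e * Q i
                  ≡⟨ solve 5 (λ a b e x z → (a :+ b) :* x :+ e :* z := e :* z :+ a :* x :+ b :* x) refl a b e (P i) (Q i) ⟩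
                e * Q i + a * P i + b * P i    ≡⟨ cong (λ y → e * Q i + a * P i + b * y) (P≗R i) ⟩
                e * Q i + a * P i + b * R i    ≡⟨ rel i ⟩
                0#                             ∎)
        ...   | inj₁ P≗Q = contradiction P≗Q (Q≢ P∈)
        ...   | inj₂ (a+b≡0 , e≡0) = +≡0⇒≡ a+b≡0 , inj₁ e≡0
        link-points {a} {b} {e} {P} {R} P∈ R∈ rel | no P≢R with e ≟ 0#
        ... | yes refl with normalized-independent (KP.normalized P∈) (KP.normalized R∈)
                (λ i → trans (solve 3 (λ x y z → x :+ y := con false :* z :+ x :+ y) refl (a * P i) (b * R i) (Q i)) (rel i))
        ...   | inj₁ P≗R = contradiction P≗R P≢R
        ...   | inj₂ (a≡0 , b≡0) = trans a≡0 (sym b≡0) , inj₁ refl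
        link-points {a} {b} {e} {P} {R} P∈ R∈ rel | no P≢R | no e≢0 =
          a≡b , inj₂ (inv e * a , critical , sym (trans (*-comm _ _) (*-inv-cancel e≢0 a)))
          where
          on : Q ≗ (((inv e * a) · P) ⊕ ((inv e * b) · R))
          on = solve-first Q P R e≢0 rel

          same : inv e * a ≡ inv e * b
          same = equal-coefficients P∈ R∈ P≢R on

          a≡b : a ≡ b
          a≡b = *-cancel (inv-nonzero e≢0) same

          critical : inv e * a ∈ coefficients
          critical = ∈-coefficients P∈ R∈ P≢R λ i → trans (on i) (cong (λ z → inv e * a * P i + z * R i) (sym same))

        plane-link : ∀ {p₁ p₂ a b c α} → p₁ ∈ coordsK → p₂ ∈ coordsK → Dep a b c p₁ p₂ (α ∷ zeros 2) →
          a ≡ b × Forbidden (c * α) a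
        plane-link {a = a} {b} {c} {α} p₁∈ p₂∈ d with origin p₁∈ | origin p₂∈
        ... | P , P∈ , refl | R , R∈ , refl = link-points P∈ R∈ λ i → begin
          c * α * Q i + a * P i + b * R i
            ≡⟨ solve 5 (λ c α z x y → c :* α :* z :+ x :+ y := x :+ y :+ c :* (α :* z)) refl c α (Q i) (a * P i) (b * R i) ⟩
          a * P i + b * R i + c * (α * Q i)
            ≡⟨ Dep⇒relation P R (α · Q) (subst (Dep a b c (coords P) (coords R)) (sym (coords-multiple α)) d) i ⟩
          0# ∎

        realize : ∀ α β γ → ∃ λ V → coords V ≡ α ∷ β ∷ γ ∷ []
        realize α β γ = (λ i → α * Q i + β * A i + inv μ * γ * B i) ,
          trans (coords-unique λ _ → refl) (cong (λ z → α ∷ β ∷ z ∷ []) (*-inv-cancel μ≢0 γ))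

        -- A nonzero vector is normalized, represented by `unequal-or-Q` and scaled back, which
        -- keeps the coefficients nonzero and unequal. The zero vector and the multiples of Q are
        -- exactly where (β, γ) is zero.
        plane-covering : ∀ α r → Decomposes coordsK r α
        plane-covering α (β ∷ γ ∷ []) with realize α β γ
        ... | V , V≡ with leading V
        ...   | inj₂ V≡0 = inj₁ (cong Vec.tail (trans (sym V≡)
                  (trans (coords-cong λ i → trans (V≡0 i) (sym (zeroˡ (Q i)))) (coords-multiple 0#))))
        ...   | inj₁ (k , Vk≢0 , _) = from-normal (unequal-or-Q θ≢0 θ≢1 (scalar-normalizes V λ V≡0 → Vk≢0 (V≡0 k)))
          where
          s : Carrier
          s = scalar V

          s≢0 : s ≢ 0#
          s≢0 = scalar-nonzero V

          unscale : ∀ {Z} → normalize V ≗ Z → V ≗ (inv s · Z)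
          unscale e i = trans (sym (inv-*-cancel s≢0 (V i))) (cong (inv s *_) (e i))

          from-normal : Unequal (normalize V) ⊎ normalize V ≗ Q → Decomposes coordsK (β ∷ γ ∷ []) α
          from-normal (inj₂ Z≗Q) = inj₁ (cong Vec.tail (trans (sym V≡)
            (trans (coords-cong (unscale Z≗Q)) (coords-multiple (inv s)))))
          from-normal (inj₁ (P , R , P∈ , R∈ , c₁ , c₂ , c₁≢0 , c₂≢0 , c₁≢c₂ , e)) =
            inj₂ (coords P , coords R , inv s * c₁ , inv s * c₂ , ∈-map⁺ coords P∈ , ∈-map⁺ coords R∈ ,
                  *-nonzero (inv-nonzero s≢0) c₁≢0 , *-nonzero (inv-nonzero s≢0) c₂≢0 ,
                  (λ e′ → c₁≢c₂ (*-cancel (inv-nonzero s≢0) e′)) ,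
                  subst (Dep (inv s * c₁) (inv s * c₂) 1# (coords P) (coords R)) V≡
                    (relation⇒Dep P R V λ i → ≡⇒+≡0 (begin
                      inv s * c₁ * P i + inv s * c₂ * R i
                        ≡⟨ solve 5 (λ s a b x y → s :* a :* x :+ s :* b :* y := s :* (a :* x :+ b :* y))
                             refl (inv s) c₁ c₂ (P i) (R i) ⟩
                      inv s * (c₁ * P i + c₂ * R i)   ≡⟨ unscale e i ⟨
                      V i                             ≡⟨ *-identityˡ (V i) ⟨
                      1# * V i                        ∎)))

      plane-base : Base coordsK
      plane-base = record
        { isCap = record { independent₁ = cap₁ ; independent₂ = cap₂ ; independent₃ = cap₃ }
        ; link = plane-link
        ; isCovering = plane-covering
        }

      private
        abstract
          parabola-zeroˡ : ∀ {a b X β γ} → a ≢ 0# → b * X ≡ a * β → b * (X * X) ≡ a * γ → β ≡ 0# → γ ≡ 0#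
          parabola-zeroˡ {a} {b} {X} a≢0 e₁ e₂ refl = *-zero-cancel a≢0 (trans (sym e₂)
            (trans (sym (*-assoc b X X)) (trans (cong (_* X) (trans e₁ (zeroʳ a))) (zeroˡ X))))

          parabola-zeroʳ : ∀ {a b X β γ} → a ≢ 0# → b * X ≡ a * β → b * (X * X) ≡ a * γ → γ ≡ 0# → β ≡ 0#
          parabola-zeroʳ {a} {b} {X} {β} a≢0 e₁ e₂ refl = square-zero (*-zero-cancel a≢0 (*-zero-cancel a≢0 (begin
            a * (a * (β * β))      ≡⟨ solve 2 (λ a x → a :* (a :* (x :* x)) := (a :* x) :* (a :* x)) refl a β ⟩
            (a * β) * (a * β)      ≡⟨ cong (λ z → z * z) e₁ ⟨
            (b * X) * (b * X)      ≡⟨ solve 2 (λ b x → (b :* x) :* (b :* x) := b :* (b :* (x :* x))) refl b X ⟩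
            b * (b * (X * X))      ≡⟨ cong (b *_) (trans e₂ (zeroʳ a)) ⟩
            b * 0#                 ≡⟨ zeroʳ b ⟩
            0#                     ∎)))

          -- Eliminates X: with b = c(aα), the square of aβ is b times bX², that is b(aγ), and a²
          -- cancels.
          conic-equation : ∀ {a c α X β γ} → a ≢ 0# → c * (a * α) * X ≡ a * β → c * (a * α) * (X * X) ≡ a * γ →
            β * β ≡ c * α * γ
          conic-equation {a} {c} {α} {X} {β} {γ} a≢0 e₁ e₂ = *-cancel a≢0 (*-cancel a≢0 (begin
            a * (a * (β * β))      ≡⟨ solve 2 (λ a x → a :* (a :* (x :* x)) := (a :* x) :* (a :* x)) refl a β ⟩
            (a * β) * (a * β)      ≡⟨ cong (λ z → z * z) e₁ ⟨
            (c * (a * α) * X) * (c * (a * α) * X)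
              ≡⟨ solve 2 (λ b x → (b :* x) :* (b :* x) := b :* (b :* (x :* x))) refl (c * (a * α)) X ⟩
            c * (a * α) * (c * (a * α) * (X * X))  ≡⟨ cong (c * (a * α) *_) e₂ ⟩
            c * (a * α) * (a * γ)
              ≡⟨ solve 4 (λ c a α γ → c :* (a :* α) :* (a :* γ) := a :* (a :* (c :* α :* γ))) refl c a α γ ⟩
            a * (a * (c * α * γ))  ∎))

        -- A = (0, 1, 0) and B = (0, 0, μ) are no multiples of (0, X, X²), whatever b is. Any other
        -- P has ξ nonzero, for otherwise it would lie on AB; then b = c(aξ) and the conic equation
        -- holds, against the choice of μ.
        outside : ∀ {P a b X} → P ∈ K → a ≢ 0# → Forbidden (a * ξ P) b →
          b * X ≡ a * η P → b * (X * X) ≡ a * (μ * ζ P) → ⊥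
        outside {P} {a} {b} {X} P∈ a≢0 forbidden e₁ e₂ with P ≗? A | P ≗? B
        ... | yes P≗A | _ with coordinates-unique {P} {0#} {1#} {0#} (λ i → trans (P≗A i)
                (solve 3 (λ x y z → y := con false :* x :+ con true :* y :+ con false :* z) refl (Q i) (A i) (B i)))
        ...   | _ , η≡1 , ζ≡0 =
                0#≢1# (trans (sym (parabola-zeroʳ a≢0 e₁ e₂ (trans (cong (μ *_) ζ≡0) (zeroʳ μ)))) η≡1)
        outside {P} {a} {b} {X} P∈ a≢0 forbidden e₁ e₂ | no _ | yes P≗B
          with coordinates-unique {P} {0#} {0#} {1#} (λ i → trans (P≗B i)
                (solve 3 (λ x y z → z := con false :* x :+ con false :* y :+ con true :* z) refl (Q i) (A i) (B i)))
        ...   | _ , η≡0 , ζ≡1 =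
                0#≢1# (trans (sym (*-zero-cancel μ≢0 (parabola-zeroˡ a≢0 e₁ e₂ η≡0))) ζ≡1)
        outside {P} {a} {b} {X} P∈ a≢0 (inj₁ aξ≡0) e₁ e₂ | no P≢A | no P≢B
          with KP.independent P∈ A∈ B∈ (λ i → begin
                 1# * P i + η P * A i + ζ P * B i
                   ≡⟨ cong (λ z → 1# * z + η P * A i + ζ P * B i) (expand P i) ⟩
                 1# * (ξ P * Q i + η P * A i + ζ P * B i) + η P * A i + ζ P * B i
                   ≡⟨ solve 3 (λ x y z → con true :* (x :+ y :+ z) :+ y :+ z := x) refl (ξ P * Q i) (η P * A i) (ζ P * B i) ⟩
                 ξ P * Q i   ≡⟨ cong (_* Q i) (*-zero-cancel a≢0 aξ≡0) ⟩
                 0# * Q i    ≡⟨ zeroˡ (Q i) ⟩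
                 0#          ∎)
        ... | inj₁ P≗A = P≢A P≗A
        ... | inj₂ (inj₁ P≗B) = P≢B P≗B
        ... | inj₂ (inj₂ (inj₁ A≗B)) = A≢B A≗B
        ... | inj₂ (inj₂ (inj₂ (1≡0 , _))) = 0#≢1# (sym 1≡0)
        outside {P} {a} {X = X} P∈ a≢0 (inj₂ (c , c∈ , refl)) e₁ e₂ | no P≢A | no P≢B with rest P∈
        ... | inj₁ refl = P≢A λ _ → refl
        ... | inj₂ (inj₁ refl) = P≢B λ _ → refl
        ... | inj₂ (inj₂ P∈rest) with (c * ξ P * ζ P) ≟ 0#
        ...   | no nonzero = μ∉excluded (subst (_∈ excluded) (sym μ≡) (∈-cartesianProductWith⁺ _ P∈rest c∈))
          where
          μ≡ : μ ≡ η P * η P * inv (c * ξ P * ζ P)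
          μ≡ = begin
            μ                                                        ≡⟨ inv-*-cancel nonzero μ ⟨
            inv (c * ξ P * ζ P) * (c * ξ P * ζ P * μ)                ≡⟨ *-comm _ _ ⟩
            c * ξ P * ζ P * μ * inv (c * ξ P * ζ P)
              ≡⟨ cong (_* inv (c * ξ P * ζ P)) (trans (*-assoc _ _ _) (cong (c * ξ P *_) (*-comm _ _))) ⟩
            c * ξ P * (μ * ζ P) * inv (c * ξ P * ζ P)
              ≡⟨ cong (_* inv (c * ξ P * ζ P)) (conic-equation {α = ξ P} a≢0 e₁ e₂) ⟨
            η P * η P * inv (c * ξ P * ζ P)                          ∎
        -- With a vanishing denominator `excluded` says nothing about μ. Here the conic equation
        -- gives η = 0, then ζ = 0 follows, and P would be Q.
        ...   | yes zero-product = Q≢ P∈ (normalized-unique (KP.normalized P∈) Q-normalized λ i → begin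
            P i                                ≡⟨ expand P i ⟩
            ξ P * Q i + η P * A i + ζ P * B i  ≡⟨ cong₂ (λ y z → ξ P * Q i + y * A i + z * B i) η≡0 ζ≡0 ⟩
            ξ P * Q i + 0# * A i + 0# * B i
              ≡⟨ solve 3 (λ x y z → x :+ con false :* y :+ con false :* z := x) refl (ξ P * Q i) (A i) (B i) ⟩
            ξ P * Q i                          ∎)
          where
          η≡0 : η P ≡ 0#
          η≡0 = square-zero (begin
            η P * η P              ≡⟨ conic-equation {α = ξ P} a≢0 e₁ e₂ ⟩
            c * ξ P * (μ * ζ P)    ≡⟨ solve 3 (λ x m z → x :* (m :* z) := m :* (x :* z)) refl (c * ξ P) μ (ζ P) ⟩
            μ * (c * ξ P * ζ P)    ≡⟨ cong (μ *_) zero-product ⟩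
            μ * 0#                 ≡⟨ zeroʳ μ ⟩
            0#                     ∎)

          ζ≡0 : ζ P ≡ 0#
          ζ≡0 = *-zero-cancel μ≢0 (parabola-zeroˡ a≢0 e₁ e₂ η≡0)

        fold-parabola : ∀ {a b x y z} → b * x + b * y + a * z ≡ 0# → b * (x + y) ≡ a * z
        fold-parabola e = +≡0⇒≡ (trans (cong (_+ _) (distribˡ _ _ _)) e)

      plane-avoids : Avoids {1} coordsK
      plane-avoids {w = β ∷ γ ∷ []} {a} {b} {x ∷ []} {y ∷ []} p∈ a≢0 forbidden (e₁ , e₂ , _) with origin p∈
      ... | P , P∈ , refl = outside {P} {X = x + y} P∈ a≢0 forbidden (fold-parabola e₁)
        (trans (solve 3 (λ b x y → b :* ((x :+ y) :* (x :+ y)) := b :* (x :* x :+ y :* y)) refl b x y) (fold-parabola e₂))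

-- Choice of the parameters and assembly

suc-<-pred : ∀ {x q} → x < q ∸ 1 → suc x < q
suc-<-pred {q = suc q} x<q = s≤s x<q

module Construction {q : ℕ} (F : FiniteField q)
  (1+1≡0 : FiniteField._+_ F (FiniteField.1# F) (FiniteField.1# F) ≡ FiniteField.0# F)
  (K : List (Geometry.Vect F 2)) (Q : Geometry.Vect F 2)
  (K-complete : Geometry.IsCompleteCap F 2 K) (Q-unique : Geometry.HasUniqueSumPoint F 2 K Q)
  (small : (length K ∸ 2) ℕ.* Geometry.secantsThrough F 2 K Q < q ∸ 1) where

  open Linear F 1+1≡0
  private
    module SP = SumPoint F 1+1≡0 {K} {Q} K-complete Q-unique
  open SP.SecantFrame SP.secantFrame
  open SP.Secant SP.Q-secant
  private
    module Sc = SP.Scaled A∈ B∈ A≢B off (first ∷ others) rest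

  private
    bad-count : length (first ∷ others) ℕ.* Geometry.secantsThrough F 2 K Q < q ∸ 1
    bad-count = subst (λ k → (k ∸ 2) ℕ.* Geometry.secantsThrough F 2 K Q < q ∸ 1) size small

    c-critical : c ∈ SP.coefficients
    c-critical = SP.∈-coefficients P∈ R∈ P≢R sum

    some-secant : 1 ≤ Geometry.secantsThrough F 2 K Q
    some-secant = subst (1 ≤_) SP.length-coefficients (ℕ.≤-trans (s≤s z≤n) (toℕ<n (Any.index c-critical)))

    -- One remaining point and one secant through Q make the product at least 1, so 2 is at most the
    -- product plus 1, which is less than q.
    2<q : 2 < q
    2<q = ℕ.≤-<-trans (s≤s (ℕ.*-mono-≤ (s≤s {n = length others} z≤n) some-secant)) (suc-<-pred bad-count)

    -- The extra entry 0 is what q - 1, rather than q, in the inequality pays for.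
    μ-choice : ∃ λ μ → ¬ (μ ∈ 0# ∷ Sc.excluded)
    μ-choice = avoiding (0# ∷ Sc.excluded)
      (subst (λ k → suc k < q) (sym Sc.length-excluded) (suc-<-pred bad-count))

    θ-choice : ∃ λ θ → ¬ (θ ∈ 0# ∷ 1# ∷ [])
    θ-choice = avoiding (0# ∷ 1# ∷ []) 2<q

    μ≢0 : proj₁ μ-choice ≢ 0#
    μ≢0 e = proj₂ μ-choice (here e)

    μ∉excluded : ¬ (proj₁ μ-choice ∈ Sc.excluded)
    μ∉excluded e = proj₂ μ-choice (there e)

    θ≢0 : proj₁ θ-choice ≢ 0#
    θ≢0 e = proj₂ θ-choice (here e)

    θ≢1 : proj₁ θ-choice ≢ 1#
    θ≢1 e = proj₂ θ-choice (there (here e))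

    coords : Geometry.Vect F 2 → Vector 3
    coords = Sc.coords μ≢0 μ∉excluded θ≢0 θ≢1

    coords-Q : coords Q ≡ 1# ∷ 0# ∷ 0# ∷ []
    coords-Q = trans (Sc.coords-cong μ≢0 μ∉excluded θ≢0 θ≢1 λ i → sym (*-identityˡ (Q i)))
                     (Sc.coords-multiple μ≢0 μ∉excluded θ≢0 θ≢1 1#)

    sum-coords : Dep c c 1# (coords P) (coords R) (1# ∷ 0# ∷ 0# ∷ [])
    sum-coords = subst (Dep c c 1# (coords P) (coords R)) coords-Q
      (Sc.relation⇒Dep μ≢0 μ∉excluded θ≢0 θ≢1 P R Q λ i → ≡⇒+≡0 (trans (sym (sum i)) (sym (*-identityˡ (Q i)))))

  open Stacking.Tower.Full (_∈ SP.coefficients)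
    (Sc.plane-base μ≢0 μ∉excluded θ≢0 θ≢1) (Sc.plane-avoids μ≢0 μ∉excluded θ≢0 θ≢1)
    c≢0 c-critical θ≢0 θ≢1 (∈-map⁺ coords P∈) (∈-map⁺ coords R∈) sum-coords

  -- The number of parabola blocks is `suc s`, since `full-covers` needs a layer of the arc to cover
  -- the multiples of Q.
  complete-cap : ∀ s → Σ (List (Geometry.Vect F (suc (suc s ℕ.* 2)))) λ C →
    Geometry.IsCompleteCap F (suc (suc s ℕ.* 2)) C ×
    length C ≤ 2 ℕ.* q ^ suc s ℕ.+ length K ℕ.* geomSum q (suc s)
  complete-cap s = C.points , C.complete , ℕ.≤-trans C.length-points (ℕ.≤-reflexive
    (trans (length-full (suc s))
           (cong (λ k → 2 ℕ.* q ^ suc s ℕ.+ k ℕ.* geomSum q (suc s)) (List.length-map coords K))))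
    where
    module C = Points.Completion F 1+1≡0 (suc (suc s ℕ.* 2)) (full-cap (suc s)) (full-covers s)

open import Data.Nat using (_+_; _*_)

-- The bound in odd dimension

odd-decomposition : ∀ N → N % 2 ≡ 1 → N ≡ suc (N / 2 * 2)
odd-decomposition N odd = trans (m≡m%n+[m/n]*n N 2) (cong (_+ N / 2 * 2) odd)

theorem4p8 : (N q m : ℕ) → 3 < N → N % 2 ≡ 1 → q ≡ 2 ^ m →
    (F : FiniteField q) →
    (K : List (Geometry.Vect F 2)) (Q : Geometry.Vect F 2) →
    Geometry.IsCompleteCap F 2 K →
    Geometry.HasUniqueSumPoint F 2 K Q →
    (length K ∸ 2) * Geometry.secantsThrough F 2 K Q < q ∸ 1 →
    Σ (List (Geometry.Vect F N)) λ C →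
    Geometry.IsCompleteCap F N C ×
    length C ≤ 2 * q ^ ((N ∸ 1) / 2) + length K * geomSum q ((N ∸ 1) / 2)
theorem4p8 N q m 3<N odd q≡2^m F K Q K-complete Q-unique small =
  build (N / 2) (odd-decomposition N odd) 3<N
  where
  Bound : ℕ → ℕ → Set
  Bound N k = Σ (List (Geometry.Vect F N)) λ C →
    Geometry.IsCompleteCap F N C × length C ≤ 2 * q ^ k + length K * geomSum q k

  build : ∀ {N} s → N ≡ suc (s * 2) → 3 < N → Bound N ((N ∸ 1) / 2)
  build zero refl (s≤s ())
  build (suc s) refl _ = subst (Bound (suc (suc s * 2))) (sym (m*n/n≡m (suc s) 2))
    (Construction.complete-cap F (Field.characteristic-two F m q≡2^m) K Q K-complete Q-unique small s)
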